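{- Let $\mathbb U$ be a shape whose multiplier $-\ltimes U$ is $\top$-slice fully faithful and $\top$-slice shard-free. Then the $\Phi$-rule below is sound in the presheaf model, and is indeed derivable from the elimination-by-pattern-matching rule (transp:elim) for the transpension type (stated in the context), for all types $C$. $\Phi$-rule. Given - $X,u:\mathbb U\mid\Gamma\vdash C$ type, - $X,u:\mathbb U\mid\Gamma,\_:u\in\partial\mathbb U\vdash c_\partial:C$, - $X,u:\mathbb U\mid\Gamma,L_{\mathsf t},L_\forall\vdash c_\forall:C[\mathsf{app}_\Gamma]$, - $X,u:\mathbb U\mid\Gamma,L_{\mathsf t},L_\forall,\_:u\in\partial\mathbb U\vdash c_\forall=c_\partial[\mathsf{app}_\Gamma]:C[\mathsf{app}_\Gamma]$, there is a term $X,u:\mathbb U\mid\Gamma\vdash\Phi_u\,c_\partial\,c_\forall:C$ such that - $X,u:\mathbb U\mid\Gamma,\_:u\in\partial\mathbb U\vdash\Phi_u\,c_\partial\,c_\forall=c_\partial:C$, and - if $\Gamma=(\Delta,L_\forall)$ with $X\mid\Delta$ ctx, then $X,u:\mathbb U\mid\Delta,L_\forall\vdash\Phi_u\,c_\partial\,c_\forall=c_\forall[\mathsf{const}_\Delta,L_\forall]:C$.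
   Context: Semantics. $\mathcal W$ is a category with terminal object $\top$. A multiplier for $U\in\mathcal W$ is an endofunctor $-\ltimes U:\mathcal W\to\mathcal W$ with $\top\ltimes U\cong U$, with second projection $\pi_2:W\ltimes U\to\top\ltimes U\cong U$ and fresh weakening functor $\mathsf F_U:\mathcal W\to\mathcal W/U$, $W\mapsto(W\ltimes U,\pi_2)$. It is $\top$-slice fully faithful if $\mathsf F_U$ is; $\top$-slice shard-free if $\mathsf F_U$ is essentially surjective on slice objects $(V,\psi)$ such that $\psi:V\to U$ is dimensionally split, i.e. such that $\pi_2:W\ltimes U\to U$ factors over $\psi$ for some $W$. $-\ltimes\mathbf yU$ on $\mathrm{Psh}(\mathcal W)$ is the left Kan extension of $-\ltimes U$ ($\mathbf y$ = Yoneda). For $\Xi\in\mathrm{Psh}(\mathcal W)$ with category of elements $\mathcal W/\Xi$, let $\mathsf F_U^{/\Xi}:\mathcal W/\Xi\to\mathcal W/(\Xi\ltimes\mathbf yU)$, $(W,\xi)\mapsto(W\ltimes U,\xi\ltimes\mathbf yU)$. The boundary $\Xi\ltimes\partial U\subseteq\Xi\ltimes\mathbf yU$ consists of the cells $\varphi$ (of shape $V$) for which there is no $\chi:W\ltimes U\to V$ with $\varphi\chi$ of the form $\xi\ltimes\mathbf yU$. Type system. Extensional multimode type theory MTT (Gratzer, Kavvos, Nuyts, Birkedal) with modes the shape contexts $X$ (lists of shape variables, $[\![\cdot]\!]=\top$, $[\![X,u:\mathbb U]\!]=[\![X]\!]\ltimes\mathbf yU$); mode $X$ is interpreted in the standard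 presheaf model $\mathrm{Psh}(\mathcal W/[\![X]\!])$. Judgements at mode $X$ are written $X\mid\Gamma\vdash J$. A modality $\mu:X_1\to X_2$ is a functor (its lock functor) $\mathrm{Psh}(\mathcal W/[\![X_2]\!])\to\mathrm{Psh}(\mathcal W/[\![X_1]\!])$ that has a right adjoint; it acts on contexts and substitutions as $\Gamma\mapsto(\Gamma,L_\mu)$, $\sigma\mapsto(\sigma,L_\mu)$. 2-cells $\mu\Rightarrow\nu$ are natural transformations from the lock functor of $\nu$ to that of $\mu$ and act as substitutions $(\Gamma,L_\nu)\to(\Gamma,L_\mu)$. The modal type $\langle\mu\mid A\rangle$ in $\Gamma$, for $A$ a type in $(\Gamma,L_\mu)$, has constructor $\mathrm{mod}_\mu$ taking terms $a:A$ in $(\Gamma,L_\mu)$ to terms of $\langle\mu\mid A\rangle$ in $\Gamma$, and is interpreted as a dependent right adjoint. Each mode has a universe $\mathrm{Prop}$ of (proof-irrelevant) propositions, interpreted by the subobject classifier, and a proposition $u\in\partial\mathbb U$ at mode $(X,u:\mathbb U)$ interpreted by $[\![X]\!]\ltimes\partial U\subseteq[\![X]\!]\ltimes\mathbf yU$. With $\Xi=[\![X]\!]$: $\forall_u:(X,u:\mathbb U)\to X$ is the modality with lock $L_\forall$ interpreted as left Kan extension along $\mathsf F_U^{/\Xi}$ and right adjoint precomposition with $\mathsf F_U^{/\Xi}$; $\mathsf t_u:X\to(X,u:\mathbb U)$ (transpension) is the modality with lock $L_{\mathsf t}$ interpreted as precomposition with $\mathsf F_U^{/\Xi}$ and right adjoint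 right Kan extension along $\mathsf F_U^{/\Xi}$. The unit and co-unit of the adjunction $L_\forall\dashv L_{\mathsf t}$ give natural substitutions $\mathsf{const}_\Delta:\Delta\to(\Delta,L_\forall,L_{\mathsf t})$ (for $\Delta$ at mode $X$), which is invertible when the multiplier is $\top$-slice fully faithful, and $\mathsf{app}_\Gamma:(\Gamma,L_{\mathsf t},L_\forall)\to\Gamma$ (for $\Gamma$ at mode $(X,u:\mathbb U)$). For $X,u:\mathbb U\mid\Delta,L_\forall\vdash t:\langle\mathsf t_u\mid A\rangle$ there is $X\mid\Delta\vdash\mathsf{unmerid}_u(t):A[\mathsf{const}_\Delta]$ obtained by transposition, with $\mathsf{unmerid}_u(\mathrm{mod}_{\mathsf t_u}(a))=a[\mathsf{const}_\Delta]$. On the boundary the transpension type has a unique element: $X,u:\mathbb U\mid\Gamma,\_:u\in\partial\mathbb U\vdash\mathsf{pole}:\langle\mathsf t_u\mid A\rangle$, with $t=\mathsf{pole}$ for all $t$ there. Rules whose conclusion is in a context $(\Delta,L_\forall)$ are understood to be closed under substitution; weakenings are implicit. Rule (transp:elim). Given $X,u:\mathbb U\mid\Gamma$ ctx; $X\mid\Gamma,L_{\mathsf t}\vdash A$ type; $X,u:\mathbb U\mid\Gamma,r:\langle\mathsf t_u\mid A\rangle\vdash C$ type; $X,u:\mathbb U\mid\Gamma,\_:u\in\partial\mathbb U\vdash c_{\mathsf{pole}}:C[\mathsf{pole}/r]$; $X,u:\mathbb U\mid\Gamma,L_{\mathsf t},x:A,L_\forall\vdash c_{\mathsf{merid}}:C[\mathsf{app}_\Gamma,\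 \mathrm{mod}_{\mathsf t_u}(x[\mathsf{const}^{ -1}])/r]$, where $\mathsf{const}^{ -1}:(\Gamma,L_{\mathsf t},x:A,L_\forall,L_{\mathsf t})\to(\Gamma,L_{\mathsf t},x:A)$; $X,u:\mathbb U\mid\Gamma,L_{\mathsf t},x:A,L_\forall,\_:u\in\partial\mathbb U\vdash c_{\mathsf{merid}}=c_{\mathsf{pole}}[\mathsf{app}_\Gamma]:C[\mathsf{app}_\Gamma,\mathsf{pole}/r]$; and $X,u:\mathbb U\mid\Gamma\vdash t:\langle\mathsf t_u\mid A\rangle$; one obtains $X,u:\mathbb U\mid\Gamma\vdash c:=\mathsf{case}\ t\ \{\mathsf{pole}\mapsto c_{\mathsf{pole}}\mid\mathsf{merid}\,x\mapsto c_{\mathsf{merid}}\}:C[t/r]$ such that $c=c_{\mathsf{pole}}$ when $u\in\partial\mathbb U$ (so $t=\mathsf{pole}$), and, if $\Gamma=(\Delta,L_\forall)$, then $X,u:\mathbb U\mid\Delta,L_\forall\vdash c=c_{\mathsf{merid}}[\mathsf{const}_\Delta,\ \mathsf{unmerid}_u(t)/x,\ L_\forall]:C[t/r]$. (This rule is sound when $\mathbb U$ is $\top$-slice fully faithful and shard-free.) -}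

module Defs where

open import Level using (Level; suc; _⊔_)
open import Data.Product using (Σ; _×_; _,_; proj₁; proj₂)
open import Data.List using (List; []; _∷_)
import Data.Unit.Polymorphic as Unit
open import Function.Definitions using (Bijective)
open import Relation.Nullary using (¬_)
open import Relation.Binary.Core using (Rel)
open import Relation.Binary.Bundles using (Setoid)
open import Relation.Binary.Structures using (IsEquivalence)
open import Relation.Binary.Construct.Closure.Equivalence as EqC using (EqClosure)

private
  variable
    o h o′ h′ ℓ a b s : Level

record Category (o h : Level) : Set (suc (o ⊔ h)) where
  infix  4 _≈_
  infixr 9 _∘_
  field
    Obj   : Set o
    Hom   : Obj → Obj → Set h
    _≈_   : ∀ {A B} → Rel (Hom A B) h
    id    : ∀ {A} → Hom A A
    _∘_   : ∀ {A B C} → Hom B C → Hom A B → Hom A C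
    equiv     : ∀ {A B} → IsEquivalence (_≈_ {A} {B})
    identityˡ : ∀ {A B} {f : Hom A B} → id ∘ f ≈ f
    identityʳ : ∀ {A B} {f : Hom A B} → f ∘ id ≈ f
    assoc     : ∀ {A B C D} {f : Hom A B} {g : Hom B C} {k : Hom C D} →
                (k ∘ g) ∘ f ≈ k ∘ (g ∘ f)
    ∘-cong    : ∀ {A B C} {g g′ : Hom B C} {f f′ : Hom A B} →
                g ≈ g′ → f ≈ f′ → g ∘ f ≈ g′ ∘ f′

  module ≈ {A B} = IsEquivalence (equiv {A} {B})

record Functor (C : Category o h) (D : Category o′ h′) :
    Set (o ⊔ h ⊔ o′ ⊔ h′) where
  private
    module C = Category C
    module D = Category D
  field
    F₀ : C.Obj → D.Obj
    F₁ : ∀ {A B} → C.Hom A B → D.Hom (F₀ A) (F₀ B)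
    F-cong : ∀ {A B} {f g : C.Hom A B} → f C.≈ g → F₁ f D.≈ F₁ g
    F-id   : ∀ {A} → F₁ (C.id {A}) D.≈ D.id
    F-∘    : ∀ {A B C} {f : C.Hom A B} {g : C.Hom B C} →
             F₁ (g C.∘ f) D.≈ F₁ g D.∘ F₁ f

FullyFaithful : {C : Category o h} {D : Category o′ h′} → Functor C D → Set (o ⊔ h ⊔ h′)
FullyFaithful {C = C} {D = D} F =
  ∀ A B → Bijective (Category._≈_ C {A} {B}) (Category._≈_ D) (Functor.F₁ F)

record Iso (C : Category o h) (A B : Category.Obj C) : Set h where
  open Category C
  field
    to      : Hom A B
    from    : Hom B A
    from∘to : from ∘ to ≈ id
    to∘from : to ∘ from ≈ id

record Terminal (C : Category o h) : Set (o ⊔ h) where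
  open Category C
  field
    ⊤        : Obj
    !        : ∀ {A} → Hom A ⊤
    !-unique : ∀ {A} (f : Hom A ⊤) → f ≈ !

Slice : (C : Category o h) → Category.Obj C → Category (o ⊔ h) h
Slice C U = record
  { Obj   = Σ Obj λ V → Hom V U
  ; Hom   = λ (V , ψ) (V′ , ψ′) → Σ (Hom V V′) λ f → ψ′ ∘ f ≈ ψ
  ; _≈_   = λ (f , _) (g , _) → f ≈ g
  ; id    = id , identityʳ
  ; _∘_   = λ (g , e) (f , e′) →
              g ∘ f , ≈.trans (≈.sym assoc) (≈.trans (∘-cong e ≈.refl) e′)
  ; equiv = record { refl = ≈.refl ; sym = ≈.sym ; trans = ≈.trans }
  ; identityˡ = identityˡ
  ; identityʳ = identityʳ
  ; assoc     = assoc
  ; ∘-cong    = ∘-cong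
  }
  where open Category C

record Multiplier (𝒲 : Category ℓ ℓ) (term : Terminal 𝒲) : Set ℓ where
  open Category 𝒲
  open Terminal term
  field
    U       : Obj
    functor : Functor 𝒲 𝒲
  open Functor functor
  _⋉U : Obj → Obj
  W ⋉U = F₀ W
  field
    ⊤⋉U≅U : Iso 𝒲 (⊤ ⋉U) U

  π₂ : ∀ {W} → Hom (W ⋉U) U
  π₂ = Iso.to ⊤⋉U≅U ∘ F₁ !

  𝖥 : Functor 𝒲 (Slice 𝒲 U)
  𝖥 = record
    { F₀ = λ W → W ⋉U , π₂
    ; F₁ = λ f → F₁ f ,
        ≈.trans assoc (∘-cong ≈.refl
          (≈.trans (≈.sym F-∘) (F-cong (!-unique _))))
    ; F-cong = F-cong
    ; F-id   = F-id
    ; F-∘    = F-∘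
    }

  DimensionallySplit : ∀ {V} → Hom V U → Set ℓ
  DimensionallySplit {V} ψ = Σ Obj λ W → Σ (Hom (W ⋉U) V) λ χ → ψ ∘ χ ≈ π₂

  ⊤-SliceFullyFaithful : Set ℓ
  ⊤-SliceFullyFaithful = FullyFaithful 𝖥

  ⊤-SliceShardFree : Set ℓ
  ⊤-SliceShardFree = ∀ V (ψ : Hom V U) → DimensionallySplit ψ →
    Σ Obj λ W → Iso (Slice 𝒲 U) (Functor.F₀ 𝖥 W) (V , ψ)

-- Presheaves are valued in setoids, so that the quotient in the coend
-- formula for left Kan extensions can be formed.
record Presheaf (C : Category ℓ ℓ) : Set (suc ℓ) where
  open Category C
  field
    ob : Obj → Setoid ℓ ℓ

  El : Obj → Set ℓ
  El V = Setoid.Carrier (ob V)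

  infix 4 _∼_
  _∼_ : ∀ {V} → Rel (El V) ℓ
  _∼_ {V} = Setoid._≈_ (ob V)

  infixl 10 _⟨_⟩
  field
    _⟨_⟩   : ∀ {V W} → El W → Hom V W → El V
    ⟨⟩-cong : ∀ {V W} {x y : El W} {f g : Hom V W} → x ∼ y → f ≈ g → x ⟨ f ⟩ ∼ y ⟨ g ⟩
    ⟨id⟩    : ∀ {V} {x : El V} → x ⟨ id ⟩ ∼ x
    ⟨∘⟩     : ∀ {V W Z} {x : El Z} {f : Hom V W} {g : Hom W Z} →
              x ⟨ g ∘ f ⟩ ∼ x ⟨ g ⟩ ⟨ f ⟩

  module ∼ {V} = IsEquivalence (Setoid.isEquivalence (ob V))

infix 4 _⇒_
record _⇒_ {C : Category ℓ ℓ} (P Q : Presheaf C) : Set ℓ where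
  open Category C
  private
    module P = Presheaf P
    module Q = Presheaf Q
  field
    fun     : ∀ {V} → P.El V → Q.El V
    cong    : ∀ {V} {x y : P.El V} → x P.∼ y → fun x Q.∼ fun y
    natural : ∀ {V W} {x : P.El W} {f : Hom V W} → fun x Q.⟨ f ⟩ Q.∼ fun (x P.⟨ f ⟩)

Psh : Category ℓ ℓ → Category (suc ℓ) ℓ
Psh C = record
  { Obj   = Presheaf C
  ; Hom   = _⇒_
  ; _≈_   = λ {P} {Q} σ τ → ∀ {V} (x : El P V) → _∼_ Q (fun σ x) (fun τ x)
  ; id    = λ {P} → record { fun = λ x → x ; cong = λ e → e ; natural = ∼.refl P }
  ; _∘_   = λ {P} {Q} {R} σ τ → record
      { fun     = λ x → fun σ (fun τ x)
      ; cong    = λ e → cong σ (cong τ e)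
      ; natural = ∼.trans R (natural σ) (cong σ (natural τ))
      }
  ; equiv = λ {P} {Q} → record
      { refl  = λ _ → ∼.refl Q
      ; sym   = λ e x → ∼.sym Q (e x)
      ; trans = λ e e′ x → ∼.trans Q (e x) (e′ x)
      }
  ; identityˡ = λ {P} {Q} _ → ∼.refl Q
  ; identityʳ = λ {P} {Q} _ → ∼.refl Q
  ; assoc     = λ {P} {Q} {R} {S} _ → ∼.refl S
  ; ∘-cong    = λ {P} {Q} {R} {g} e e′ x → ∼.trans R (cong g (e′ x)) (e _)
  }
  where
  open Presheaf
  open _⇒_

𝟏 : {C : Category ℓ ℓ} → Presheaf C
𝟏 = record
  { ob      = λ _ → record
      { Carrier = Unit.⊤ ; _≈_ = λ _ _ → Unit.⊤
      ; isEquivalence = record { refl = _ ; sym = _ ; trans = _ } }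
  ; _⟨_⟩    = _
  ; ⟨⟩-cong = _
  ; ⟨id⟩    = _
  ; ⟨∘⟩     = _
  }

Psh-terminal : {C : Category ℓ ℓ} → Terminal (Psh C)
Psh-terminal = record
  { ⊤        = 𝟏
  ; !        = record { fun = _ ; cong = _ ; natural = _ }
  ; !-unique = _
  }

∫ : {C : Category ℓ ℓ} → Presheaf C → Category ℓ ℓ
∫ {C = C} P = record
  { Obj   = Σ Obj El
  ; Hom   = λ (V , x) (W , y) → Σ (Hom V W) λ f → y ⟨ f ⟩ ∼ x
  ; _≈_   = λ (f , _) (g , _) → f ≈ g
  ; id    = id , ⟨id⟩
  ; _∘_   = λ (g , e) (f , e′) →
              g ∘ f , ∼.trans ⟨∘⟩ (∼.trans (⟨⟩-cong e ≈.refl) e′)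
  ; equiv = record { refl = ≈.refl ; sym = ≈.sym ; trans = ≈.trans }
  ; identityˡ = identityˡ
  ; identityʳ = identityʳ
  ; assoc     = assoc
  ; ∘-cong    = ∘-cong
  }
  where
  open Category C
  open Presheaf P

module _ {C D : Category ℓ ℓ} (F : Functor C D) where
  private
    module C = Category C
    module D = Category D
    module D≈ {A B} = IsEquivalence (D.equiv {A} {B})
  open Functor F
  open Presheaf
  open _⇒_

  record Cell (P : Presheaf C) (V : D.Obj) : Set ℓ where
    constructor cell
    field
      {shape} : C.Obj
      elt     : El P shape
      map     : D.Hom V (F₀ shape)

  open Cell

  Step : (P : Presheaf C) {V : D.Obj} → Rel (Cell P V) ℓ
  Step P (cell {W} x g) (cell {W′} x′ g′) =
    Σ (C.Hom W W′) λ f → (_∼_ P (_⟨_⟩ P x′ f) x) × (F₁ f D.∘ g D.≈ g′)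

  private
    step-id : (P : Presheaf C) {V : D.Obj} {W : C.Obj} {x x′ : El P W} {g g′ : D.Hom V (F₀ W)} →
              _∼_ P x x′ → g D.≈ g′ → EqClosure (Step P) (cell x g) (cell x′ g′)
    step-id P e e′ = EqC.return
      ( C.id
      , ∼.trans P (⟨id⟩ P) (∼.sym P e)
      , D≈.trans (D.∘-cong F-id e′) D.identityˡ )

  -- ∃ W. P W × D(V, F W), modulo the equivalence relation generated by
  -- (x ⟨ f ⟩ , g) ~ (x , F f ∘ g).
  Lan₀ : Presheaf C → Presheaf D
  Lan₀ P = record
    { ob      = λ V → EqC.setoid (Step P {V})
    ; _⟨_⟩    = λ c f → cell (elt c) (map c D.∘ f)
    ; ⟨⟩-cong = λ {V} {W} {c} {c′} {f} {g} e e′ →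
        EqC.transitive (Step P)
          (EqC.gmap (λ c → cell (elt c) (map c D.∘ f))
            (λ (k , e₁ , e₂) → k , e₁ , D≈.trans (D≈.sym D.assoc) (D.∘-cong e₂ D≈.refl)) e)
          (step-id P (∼.refl P) (D.∘-cong D≈.refl e′))
    ; ⟨id⟩    = step-id P (∼.refl P) D.identityʳ
    ; ⟨∘⟩     = step-id P (∼.refl P) (D≈.sym D.assoc)
    }

  Lan₁ : {P Q : Presheaf C} → P ⇒ Q → Lan₀ P ⇒ Lan₀ Q
  Lan₁ {P} {Q} σ = record
    { fun     = λ c → cell (fun σ (elt c)) (map c)
    ; cong    = EqC.gmap (λ c → cell (fun σ (elt c)) (map c))
        (λ (k , e₁ , e₂) → k , ∼.trans Q (natural σ) (cong σ e₁) , e₂)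
    ; natural = step-id Q (∼.refl Q) D≈.refl
    }

  Lan : Functor (Psh C) (Psh D)
  Lan = record
    { F₀     = Lan₀
    ; F₁     = Lan₁
    ; F-cong = λ {P} {Q} e c → step-id Q (e (elt c)) D≈.refl
    ; F-id   = λ {P} c → step-id P (∼.refl P) D≈.refl
    ; F-∘    = λ {P} {Q} {R} c → step-id R (∼.refl R) D≈.refl
    }

  Res₀ : Presheaf D → Presheaf C
  Res₀ Q = record
    { ob      = λ V → ob Q (F₀ V)
    ; _⟨_⟩    = λ x f → _⟨_⟩ Q x (F₁ f)
    ; ⟨⟩-cong = λ e e′ → ⟨⟩-cong Q e (F-cong e′)
    ; ⟨id⟩    = ∼.trans Q (⟨⟩-cong Q (∼.refl Q) F-id) (⟨id⟩ Q)
    ; ⟨∘⟩     = ∼.trans Q (⟨⟩-cong Q (∼.refl Q) F-∘) (⟨∘⟩ Q)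
    }

  Res : Functor (Psh D) (Psh C)
  Res = record
    { F₀     = Res₀
    ; F₁     = λ σ → record { fun = fun σ ; cong = cong σ ; natural = natural σ }
    ; F-cong = λ e x → e x
    ; F-id   = λ {P} _ → ∼.refl P
    ; F-∘    = λ {P} {Q} {R} _ → ∼.refl R
    }

  Lan-unit : (P : Presheaf C) → P ⇒ Res₀ (Lan₀ P)
  Lan-unit P = record
    { fun     = λ x → cell x D.id
    ; cong    = λ e → step-id P e D≈.refl
    ; natural = λ {_} {_} {x} {f} → EqC.symmetric (Step P) (EqC.return
        ( f , ∼.refl P , D≈.trans D.identityʳ (D≈.sym D.identityˡ) ))
    }

  Lan-counit : (Q : Presheaf D) → Lan₀ (Res₀ Q) ⇒ Q
  Lan-counit Q = record
    { fun     = λ c → _⟨_⟩ Q (elt c) (map c)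
    ; cong    = EqC.gfold (Setoid.isEquivalence (ob Q _)) (λ c → _⟨_⟩ Q (elt c) (map c))
        (λ (k , e₁ , e₂) → ∼.trans Q (⟨⟩-cong Q (∼.sym Q e₁) D≈.refl)
          (∼.trans Q (∼.sym Q (⟨∘⟩ Q)) (⟨⟩-cong Q (∼.refl Q) e₂)))
    ; natural = ∼.sym Q (⟨∘⟩ Q)
    }

  Lan-unit-natural : {P Q : Presheaf C} (σ : P ⇒ Q) {V : C.Obj} (x : El P V) →
    _∼_ (Res₀ (Lan₀ Q)) (fun (Lan₁ σ) (fun (Lan-unit P) x)) (fun (Lan-unit Q) (fun σ x))
  Lan-unit-natural {P} {Q} σ x = ∼.refl (Lan₀ Q)

  Lan-counit-natural : {P Q : Presheaf D} (σ : P ⇒ Q) {V : D.Obj} (c : Cell (Res₀ P) V) →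
    _∼_ Q (fun σ (fun (Lan-counit P) c)) (fun (Lan-counit Q) (fun (Lan₁ (Functor.F₁ Res σ)) c))
  Lan-counit-natural {P} {Q} σ c = ∼.sym Q (natural σ)

  Lan-triangle₁ : (P : Presheaf C) {V : D.Obj} (c : Cell P V) →
    EqClosure (Step P) (fun (Lan-counit (Lan₀ P)) (fun (Lan₁ (Lan-unit P)) c)) c
  Lan-triangle₁ P c = step-id P (∼.refl P) D.identityˡ

  Lan-triangle₂ : (Q : Presheaf D) {V : C.Obj} (x : El Q (F₀ V)) →
    _∼_ Q (fun (Lan-counit Q) (fun (Lan-unit (Res₀ Q)) x)) x
  Lan-triangle₂ Q x = ⟨id⟩ Q

  -- (W , x) ↦ (F W , Lan F x), where x : 𝐲W ⇒ P and Lan F (𝐲W) ≅ 𝐲(F W);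
  -- by the Yoneda lemma, Lan F x is the cell [ x , id ].
  ∫-Lan : (P : Presheaf C) → Functor (∫ P) (∫ (Lan₀ P))
  ∫-Lan P = record
    { F₀     = λ (W , x) → F₀ W , cell x D.id
    ; F₁     = λ (f , e) → F₁ f , EqC.symmetric (Step P) (EqC.return
        ( f , e , D≈.trans D.identityʳ (D≈.sym D.identityˡ) ))
    ; F-cong = F-cong
    ; F-id   = F-id
    ; F-∘    = F-∘
    }

-- Judgemental equalities are relations rather than identity types, and
-- `t ≈t u` relates terms of types that are equal but not necessarily
-- identical, so that equations can be stated without conversions.  Raw
-- syntax with its judgemental equalities and conversion rule is such a
-- structure.  Of the type formers only the unit type is required.
record CwF (a b : Level) : Set (suc (a ⊔ b)) where
  field
    ctx      : Category a b
    terminal : Terminal ctx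

  open Category ctx public
    renaming (Obj to Con; Hom to Sub; _≈_ to _≈s_; module ≈ to ≈s)
    using (id; _∘_; identityˡ; identityʳ; assoc; ∘-cong)
  open Terminal terminal public renaming (⊤ to ◇)

  infix  4 _≈T_ _≈t_
  infixl 8 _[_]T _[_]t
  infixl 5 _▹_
  field
    Ty       : Con → Set a
    _≈T_     : ∀ {Γ} → Rel (Ty Γ) a
    ≈T-equiv : ∀ {Γ} → IsEquivalence (_≈T_ {Γ})
    _[_]T    : ∀ {Γ Δ} → Ty Γ → Sub Δ Γ → Ty Δ
    []T-cong : ∀ {Γ Δ} {A B : Ty Γ} {σ τ : Sub Δ Γ} → A ≈T B → σ ≈s τ → A [ σ ]T ≈T B [ τ ]T
    [id]T    : ∀ {Γ} {A : Ty Γ} → A [ id ]T ≈T A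
    [∘]T     : ∀ {Γ Δ Θ} {A : Ty Γ} {σ : Sub Δ Γ} {τ : Sub Θ Δ} →
               A [ σ ∘ τ ]T ≈T A [ σ ]T [ τ ]T

    Tm       : ∀ Γ → Ty Γ → Set b
    _≈t_     : ∀ {Γ} {A B : Ty Γ} → Tm Γ A → Tm Γ B → Set a
    ≈t-type  : ∀ {Γ} {A B : Ty Γ} {t : Tm Γ A} {u : Tm Γ B} → t ≈t u → A ≈T B
    ≈t-refl  : ∀ {Γ} {A : Ty Γ} {t : Tm Γ A} → t ≈t t
    ≈t-sym   : ∀ {Γ} {A B : Ty Γ} {t : Tm Γ A} {u : Tm Γ B} → t ≈t u → u ≈t t
    ≈t-trans : ∀ {Γ} {A B C : Ty Γ} {t : Tm Γ A} {u : Tm Γ B} {v : Tm Γ C} →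
               t ≈t u → u ≈t v → t ≈t v
    coe      : ∀ {Γ} {A B : Ty Γ} → A ≈T B → Tm Γ A → Tm Γ B
    coe-≈    : ∀ {Γ} {A B : Ty Γ} (e : A ≈T B) (t : Tm Γ A) → coe e t ≈t t
    _[_]t    : ∀ {Γ Δ} {A : Ty Γ} → Tm Γ A → (σ : Sub Δ Γ) → Tm Δ (A [ σ ]T)
    []t-cong : ∀ {Γ Δ} {A B : Ty Γ} {t : Tm Γ A} {u : Tm Γ B} {σ τ : Sub Δ Γ} →
               t ≈t u → σ ≈s τ → t [ σ ]t ≈t u [ τ ]t
    [id]t    : ∀ {Γ} {A : Ty Γ} {t : Tm Γ A} → t [ id ]t ≈t t
    [∘]t     : ∀ {Γ Δ Θ} {A : Ty Γ} {t : Tm Γ A} {σ : Sub Δ Γ} {τ : Sub Θ Δ} →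
               t [ σ ∘ τ ]t ≈t t [ σ ]t [ τ ]t

    _▹_      : ∀ Γ → Ty Γ → Con
    p        : ∀ {Γ} {A : Ty Γ} → Sub (Γ ▹ A) Γ
    q        : ∀ {Γ} {A : Ty Γ} → Tm (Γ ▹ A) (A [ p ]T)
    ⟨_,_⟩    : ∀ {Γ Δ} {A : Ty Γ} (σ : Sub Δ Γ) → Tm Δ (A [ σ ]T) → Sub Δ (Γ ▹ A)
    ⟨,⟩-cong : ∀ {Γ Δ} {A : Ty Γ} {σ τ : Sub Δ Γ} {t : Tm Δ (A [ σ ]T)} {u : Tm Δ (A [ τ ]T)} →
               σ ≈s τ → t ≈t u → ⟨_,_⟩ {A = A} σ t ≈s ⟨ τ , u ⟩
    p-⟨,⟩    : ∀ {Γ Δ} {A : Ty Γ} {σ : Sub Δ Γ} {t : Tm Δ (A [ σ ]T)} →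
               p ∘ ⟨_,_⟩ {A = A} σ t ≈s σ
    q-⟨,⟩    : ∀ {Γ Δ} {A : Ty Γ} {σ : Sub Δ Γ} {t : Tm Δ (A [ σ ]T)} →
               q [ ⟨_,_⟩ {A = A} σ t ]t ≈t t
    ⟨,⟩-η    : ∀ {Γ Δ} {A : Ty Γ} {σ : Sub Δ (Γ ▹ A)} {t : Tm Δ (A [ p ∘ σ ]T)} →
               t ≈t q [ σ ]t → ⟨_,_⟩ {A = A} (p ∘ σ) t ≈s σ

    𝟙   : ∀ {Γ} → Ty Γ
    𝟙[] : ∀ {Γ Δ} {σ : Sub Δ Γ} → 𝟙 [ σ ]T ≈T 𝟙
    ⋆   : ∀ {Γ} → Tm Γ 𝟙
    𝟙-η : ∀ {Γ} (t : Tm Γ 𝟙) → t ≈t ⋆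

  module ≈T {Γ} = IsEquivalence (≈T-equiv {Γ})

  ⟨id,_⟩ : ∀ {Γ} {A : Ty Γ} → Tm Γ A → Sub Γ (Γ ▹ A)
  ⟨id, t ⟩ = ⟨ id , coe (≈T.sym [id]T) t ⟩

  lift : ∀ {Γ Δ} (σ : Sub Δ Γ) {A : Ty Γ} {A′ : Ty Δ} → A′ ≈T A [ σ ]T → Sub (Δ ▹ A′) (Γ ▹ A)
  lift σ e = ⟨ σ ∘ p , coe (≈T.trans ([]T-cong e ≈s.refl) (≈T.sym [∘]T)) q ⟩

-- Modes are shape contexts; the shape context (X, u : 𝕌) is u ∷ X.  L∀ and
-- Lt are the locks of the modalities ∀_u : (X, u : 𝕌) → X and
-- 𝗍_u : X → (X, u : 𝕌); const and app are the unit and co-unit of L∀ ⊣ Lt.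
record Model (Shape : Set s) (a b : Level) : Set (s ⊔ suc (a ⊔ b)) where
  field
    cwf : List Shape → CwF a b

  open module Modes {X} = CwF (cwf X) public

  field
    L∀-functor : ∀ X u → Functor (CwF.ctx (cwf X)) (CwF.ctx (cwf (u ∷ X)))
    Lt-functor : ∀ X u → Functor (CwF.ctx (cwf (u ∷ X))) (CwF.ctx (cwf X))

  L∀ : ∀ {X u} → Con {X} → Con {u ∷ X}
  L∀ {X} {u} = Functor.F₀ (L∀-functor X u)

  L∀₁ : ∀ {X u} {Δ Θ : Con {X}} → Sub Δ Θ → Sub (L∀ {X} {u} Δ) (L∀ Θ)
  L∀₁ {X} {u} = Functor.F₁ (L∀-functor X u)

  Lt : ∀ {X u} → Con {u ∷ X} → Con {X}
  Lt {X} {u} = Functor.F₀ (Lt-functor X u)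

  Lt₁ : ∀ {X u} {Γ Θ : Con {u ∷ X}} → Sub Γ Θ → Sub (Lt {X} {u} Γ) (Lt Θ)
  Lt₁ {X} {u} = Functor.F₁ (Lt-functor X u)

  field
    const : ∀ {X u} (Δ : Con {X}) → Sub Δ (Lt (L∀ {X} {u} Δ))
    app   : ∀ {X u} (Γ : Con {u ∷ X}) → Sub (L∀ (Lt Γ)) Γ
    const-natural : ∀ {X u} {Δ Θ : Con {X}} (σ : Sub Δ Θ) →
      Lt₁ (L∀₁ σ) ∘ const {X} {u} Δ ≈s const Θ ∘ σ
    app-natural   : ∀ {X u} {Γ Θ : Con {u ∷ X}} (σ : Sub Γ Θ) →
      σ ∘ app Γ ≈s app Θ ∘ L∀₁ (Lt₁ σ)
    triangle-∀    : ∀ {X u} (Δ : Con {X}) → app (L∀ {X} {u} Δ) ∘ L∀₁ (const Δ) ≈s id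
    triangle-t    : ∀ {X u} (Γ : Con {u ∷ X}) → Lt₁ (app Γ) ∘ const (Lt Γ) ≈s id

    -- (the type of proofs of) the proposition u ∈ ∂𝕌
    ∂       : ∀ {X u} {Γ : Con {u ∷ X}} → Ty Γ
    ∂[]     : ∀ {X u} {Γ Δ : Con {u ∷ X}} {σ : Sub Δ Γ} → ∂ {X} {u} [ σ ]T ≈T ∂ {X} {u}
    ∂-irrel : ∀ {X u} {Γ : Con {u ∷ X}} (t t′ : Tm Γ (∂ {X} {u})) → t ≈t t′

  module _ {X : List Shape} {u : Shape} where
    _▹∂ : Con {u ∷ X} → Con {u ∷ X}
    Γ ▹∂ = Γ ▹ ∂ {X} {u}

    p∂ : {Γ : Con {u ∷ X}} → Sub (Γ ▹∂) Γ
    p∂ = p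

    lift∂ : {Γ Δ : Con {u ∷ X}} → Sub Δ Γ → Sub (Δ ▹∂) (Γ ▹∂)
    lift∂ σ = lift σ (≈T.sym ∂[])

-- A premise "Γ = (Δ, L∀)" is rendered by instantiating Γ.  For every term
-- former, the field `-natural` expresses stability both under substitution
-- and under judgemental equality of the arguments.  A rule is derivable from
-- other rules when it holds in every model of those rules.
module Rules {Shape : Set s} {a b : Level} (M : Model Shape a b) (X : List Shape) (u : Shape) where
  open Model M

  private
    Conᵘ : Set a
    Conᵘ = Con {u ∷ X}

    Conˣ : Set a
    Conˣ = Con {X}

  record PhiRule : Set (suc (a ⊔ b)) where
    field
      Φ : {Γ : Conᵘ} (C : Ty Γ)
          (c∂ : Tm (Γ ▹∂) (C [ p∂ ]T))
          (c∀ : Tm (L∀ (Lt Γ)) (C [ app Γ ]T)) →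
          c∀ [ p∂ ]t ≈t c∂ [ lift∂ (app Γ) ]t →
          Tm Γ C

      Φ-natural : {Γ Δ : Conᵘ} (σ : Sub Δ Γ)
          {C : Ty Γ} {c∂ : Tm (Γ ▹∂) (C [ p∂ ]T)} {c∀ : Tm (L∀ (Lt Γ)) (C [ app Γ ]T)}
          {e : c∀ [ p∂ ]t ≈t c∂ [ lift∂ (app Γ) ]t}
          {C′ : Ty Δ} {c∂′ : Tm (Δ ▹∂) (C′ [ p∂ ]T)} {c∀′ : Tm (L∀ (Lt Δ)) (C′ [ app Δ ]T)}
          {e′ : c∀′ [ p∂ ]t ≈t c∂′ [ lift∂ (app Δ) ]t} →
          C′ ≈T C [ σ ]T →
          c∂′ ≈t c∂ [ lift∂ σ ]t →
          c∀′ ≈t c∀ [ L∀₁ (Lt₁ σ) ]t →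
          Φ C′ c∂′ c∀′ e′ ≈t Φ C c∂ c∀ e [ σ ]t

      Φ-∂ : {Γ : Conᵘ} {C : Ty Γ}
          {c∂ : Tm (Γ ▹∂) (C [ p∂ ]T)} {c∀ : Tm (L∀ (Lt Γ)) (C [ app Γ ]T)}
          {e : c∀ [ p∂ ]t ≈t c∂ [ lift∂ (app Γ) ]t} →
          Φ C c∂ c∀ e [ p∂ ]t ≈t c∂

      Φ-∀ : {Δ : Conˣ} {C : Ty (L∀ Δ)}
          {c∂ : Tm (L∀ Δ ▹∂) (C [ p∂ ]T)} {c∀ : Tm (L∀ (Lt (L∀ Δ))) (C [ app (L∀ Δ) ]T)}
          {e : c∀ [ p∂ ]t ≈t c∂ [ lift∂ (app (L∀ Δ)) ]t} →
          Φ C c∂ c∀ e ≈t c∀ [ L∀₁ (const Δ) ]t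

  -- const⁻¹ is available because the multiplier is ⊤-slice fully faithful.
  -- Of ⟨t∣ A ⟩ being a dependent right adjoint only mod, its transposition
  -- unmerid and the β-law are required.
  record Transpension : Set (suc (a ⊔ b)) where
    field
      const⁻¹       : (Δ : Conˣ) → Sub (Lt (L∀ {X} {u} Δ)) Δ
      const⁻¹-const : {Δ : Conˣ} → const⁻¹ Δ ∘ const Δ ≈s id
      const-const⁻¹ : {Δ : Conˣ} → const Δ ∘ const⁻¹ Δ ≈s id

      ⟨t∣_⟩    : {Γ : Conᵘ} → Ty (Lt Γ) → Ty Γ
      ⟨t∣⟩-natural : {Γ Δ : Conᵘ} (σ : Sub Δ Γ) {A : Ty (Lt Γ)} {A′ : Ty (Lt Δ)} →
        A′ ≈T A [ Lt₁ σ ]T → ⟨t∣ A′ ⟩ ≈T ⟨t∣ A ⟩ [ σ ]T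

      mod         : {Γ : Conᵘ} {A : Ty (Lt Γ)} → Tm (Lt Γ) A → Tm Γ ⟨t∣ A ⟩
      mod-natural : {Γ Δ : Conᵘ} (σ : Sub Δ Γ)
        {A : Ty (Lt Γ)} {t : Tm (Lt Γ) A} {A′ : Ty (Lt Δ)} {t′ : Tm (Lt Δ) A′} →
        t′ ≈t t [ Lt₁ σ ]t → mod t′ ≈t mod t [ σ ]t

      unmerid         : {Δ : Conˣ} {A : Ty (Lt (L∀ Δ))} → Tm (L∀ Δ) ⟨t∣ A ⟩ → Tm Δ (A [ const Δ ]T)
      unmerid-natural : {Δ Θ : Conˣ} (σ : Sub Θ Δ)
        {A : Ty (Lt (L∀ Δ))} {t : Tm (L∀ Δ) ⟨t∣ A ⟩}
        {A′ : Ty (Lt (L∀ Θ))} {t′ : Tm (L∀ Θ) ⟨t∣ A′ ⟩} →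
        A′ ≈T A [ Lt₁ (L∀₁ σ) ]T → t′ ≈t t [ L∀₁ σ ]t → unmerid t′ ≈t unmerid t [ σ ]t
      unmerid-mod     : {Δ : Conˣ} {A : Ty (Lt (L∀ Δ))} {t : Tm (Lt (L∀ Δ)) A} →
        unmerid (mod t) ≈t t [ const Δ ]t

      pole        : {Γ : Conᵘ} {A : Ty (Lt Γ)} → Tm (Γ ▹∂) (⟨t∣ A ⟩ [ p∂ ]T)
      pole-unique : {Γ : Conᵘ} {A : Ty (Lt Γ)} (t : Tm (Γ ▹∂) (⟨t∣ A ⟩ [ p∂ ]T)) → t ≈t pole {A = A}

    [p,pole] : {Γ : Conᵘ} {A : Ty (Lt Γ)} → Sub (Γ ▹∂) (Γ ▹ ⟨t∣ A ⟩)
    [p,pole] {A = A} = ⟨ p∂ , pole {A = A} ⟩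

    private
      app-const⁻¹ : {Γ : Conᵘ} {A : Ty (Lt Γ)} →
        Lt₁ (app Γ ∘ L∀₁ (p {A = A})) ≈s p ∘ const⁻¹ (Lt Γ ▹ A)
      app-const⁻¹ {Γ} {A} =
        ≈s.trans (Functor.F-∘ (Lt-functor X u))
        (≈s.trans (≈s.sym identityʳ)
        (≈s.trans (∘-cong ≈s.refl (≈s.sym const-const⁻¹))
        (≈s.trans (≈s.sym assoc)
        (∘-cong
          (≈s.trans assoc
          (≈s.trans (∘-cong ≈s.refl (const-natural p))
          (≈s.trans (≈s.sym assoc)
          (≈s.trans (∘-cong (triangle-t Γ) ≈s.refl)
          identityˡ))))
          ≈s.refl))))

    -- (app_Γ , mod (x [ const⁻¹ ])) : (Γ, Lt, x : A, L∀) → (Γ, r : ⟨ t ∣ A ⟩)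
    [app,merid] : {Γ : Conᵘ} {A : Ty (Lt Γ)} → Sub (L∀ (Lt Γ ▹ A)) (Γ ▹ ⟨t∣ A ⟩)
    [app,merid] {Γ} {A} =
      ⟨ app Γ ∘ L∀₁ p
      , coe (⟨t∣⟩-natural (app Γ ∘ L∀₁ p)
              (≈T.trans (≈T.sym [∘]T) ([]T-cong ≈T.refl (≈s.sym app-const⁻¹))))
            (mod (q [ const⁻¹ (Lt Γ ▹ A) ]t))
      ⟩

  record TranspElim (T : Transpension) : Set (suc (a ⊔ b)) where
    open Transpension T

    -- c_merid = c_pole [ app_Γ ] on the boundary; the substitution is
    -- app_Γ ∘ (weakening of x : A), extended with the proof of u ∈ ∂𝕌
    Coherent : {Γ : Conᵘ} {A : Ty (Lt Γ)} {C : Ty (Γ ▹ ⟨t∣ A ⟩)} →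
      Tm (Γ ▹∂) (C [ [p,pole] ]T) → Tm (L∀ (Lt Γ ▹ A)) (C [ [app,merid] ]T) → Set a
    Coherent {Γ} cpole cmerid =
      cmerid [ p∂ ]t ≈t cpole [ lift∂ (app Γ ∘ L∀₁ p) ]t

    field
      case : {Γ : Conᵘ} {A : Ty (Lt Γ)} (C : Ty (Γ ▹ ⟨t∣ A ⟩))
        (cpole : Tm (Γ ▹∂) (C [ [p,pole] ]T))
        (cmerid : Tm (L∀ (Lt Γ ▹ A)) (C [ [app,merid] ]T)) →
        Coherent cpole cmerid →
        (t : Tm Γ ⟨t∣ A ⟩) → Tm Γ (C [ ⟨id, t ⟩ ]T)

      case-natural : {Γ Δ : Conᵘ} (σ : Sub Δ Γ)
        {A : Ty (Lt Γ)} {C : Ty (Γ ▹ ⟨t∣ A ⟩)}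
        {cpole : Tm (Γ ▹∂) (C [ [p,pole] ]T)}
        {cmerid : Tm (L∀ (Lt Γ ▹ A)) (C [ [app,merid] ]T)}
        {e : Coherent cpole cmerid} {t : Tm Γ ⟨t∣ A ⟩}
        {A′ : Ty (Lt Δ)} {C′ : Ty (Δ ▹ ⟨t∣ A′ ⟩)}
        {cpole′ : Tm (Δ ▹∂) (C′ [ [p,pole] ]T)}
        {cmerid′ : Tm (L∀ (Lt Δ ▹ A′)) (C′ [ [app,merid] ]T)}
        {e′ : Coherent cpole′ cmerid′} {t′ : Tm Δ ⟨t∣ A′ ⟩} →
        (A≈ : A′ ≈T A [ Lt₁ σ ]T) →
        C′ ≈T C [ lift σ (⟨t∣⟩-natural σ A≈) ]T →
        cpole′ ≈t cpole [ lift∂ σ ]t →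
        cmerid′ ≈t cmerid [ L∀₁ (lift (Lt₁ σ) A≈) ]t →
        t′ ≈t t [ σ ]t →
        case C′ cpole′ cmerid′ e′ t′ ≈t case C cpole cmerid e t [ σ ]t

      case-pole : {Γ : Conᵘ} {A : Ty (Lt Γ)} {C : Ty (Γ ▹ ⟨t∣ A ⟩)}
        {cpole : Tm (Γ ▹∂) (C [ [p,pole] ]T)}
        {cmerid : Tm (L∀ (Lt Γ ▹ A)) (C [ [app,merid] ]T)}
        {e : Coherent cpole cmerid} {t : Tm Γ ⟨t∣ A ⟩} →
        case C cpole cmerid e t [ p∂ ]t ≈t cpole

      case-merid : {Δ : Conˣ} {A : Ty (Lt (L∀ Δ))} {C : Ty (L∀ Δ ▹ ⟨t∣ A ⟩)}
        {cpole : Tm (L∀ Δ ▹∂) (C [ [p,pole] ]T)}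
        {cmerid : Tm (L∀ (Lt (L∀ Δ) ▹ A)) (C [ [app,merid] ]T)}
        {e : Coherent cpole cmerid} {t : Tm (L∀ Δ) ⟨t∣ A ⟩} →
        case C cpole cmerid e t ≈t cmerid [ L∀₁ ⟨ const Δ , unmerid t ⟩ ]t

open Rules public using (PhiRule; Transpension; TranspElim)

-- Types over Γ are presheaves over ∫ Γ.  As ∫ Γ is functorial in Γ only up
-- to the setoid equality of Γ, a type carries a delayed substitution: it is
-- a presheaf over some ∫ B together with a morphism Γ ⇒ B.  Up to isomorphism
-- these are the same types (take B = Γ), and type equality is a relation.
module PshCwF (C : Category ℓ ℓ) where
  open Category C
  open Presheaf
  open _⇒_

  infix 6 _⟪_⟫
  record Type (Γ : Presheaf C) : Set (suc ℓ) where
    constructor _⟪_⟫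
    field
      {base} : Presheaf C
      fam    : Presheaf (∫ base)
      sub    : Γ ⇒ base

  record Term (Γ : Presheaf C) (A : Type Γ) : Set ℓ where
    open Type A
    field
      val         : ∀ {V} (γ : El Γ V) → El fam (V , fun sub γ)
      val-natural : ∀ {V W} {γ : El Γ W} {γ′ : El Γ V} (f : Hom V W) →
        _∼_ Γ (_⟨_⟩ Γ γ f) γ′ →
        (e : _∼_ base (_⟨_⟩ base (fun sub γ) f) (fun sub γ′)) →
        _∼_ fam (_⟨_⟩ fam (val γ) (f , e)) (val γ′)

  open Term public

  data TypeEq {Γ : Presheaf C} : Type Γ → Type Γ → Set (suc ℓ) where
    type-eq : ∀ {B} {F : Presheaf (∫ B)} {σ τ : Γ ⇒ B} →
      (∀ {V} (γ : El Γ V) → _∼_ B (fun σ γ) (fun τ γ)) →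
      TypeEq (F ⟪ σ ⟫) (F ⟪ τ ⟫)

  data TermEq {Γ : Presheaf C} : {A A′ : Type Γ} → Term Γ A → Term Γ A′ → Set (suc ℓ) where
    term-eq : ∀ {B} {F : Presheaf (∫ B)} {σ τ : Γ ⇒ B}
      {t : Term Γ (F ⟪ σ ⟫)} {t′ : Term Γ (F ⟪ τ ⟫)} →
      (∀ {V} (γ : El Γ V) → _∼_ B (fun σ γ) (fun τ γ)) →
      (∀ {V} (γ : El Γ V) (e : _∼_ B (_⟨_⟩ B (fun σ γ) id) (fun τ γ)) →
        _∼_ F (_⟨_⟩ F (val t γ) (id , e)) (val t′ γ)) →
      TermEq t t′

  private
    module _ (B : Presheaf C) (F : Presheaf (∫ B)) where
      comp : ∀ {V W Z x y z} (a : El F (Z , z)) {g : Hom W Z} {f : Hom V W} {k : Hom V Z}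
        (e : _∼_ B (_⟨_⟩ B z g) y) (e′ : _∼_ B (_⟨_⟩ B y f) x) (e″ : _∼_ B (_⟨_⟩ B z k) x) →
        g ∘ f ≈ k →
        _∼_ F (_⟨_⟩ F (_⟨_⟩ F a (g , e)) (f , e′)) (_⟨_⟩ F a (k , e″))
      comp a e e′ e″ eq = ∼.trans F (∼.sym F (⟨∘⟩ F)) (⟨⟩-cong F (∼.refl F) eq)

      same : ∀ {V x} (a : El F (V , x)) (e : _∼_ B (_⟨_⟩ B x id) x) →
        _∼_ F (_⟨_⟩ F a (id , e)) a
      same a e = ∼.trans F (⟨⟩-cong F (∼.refl F) ≈.refl) (⟨id⟩ F)

      square : ∀ {V W W′ Z x y y′ z} (a : El F (Z , z))
        {g : Hom W Z} {f : Hom V W} {g′ : Hom W′ Z} {f′ : Hom V W′}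
        (e₁ : _∼_ B (_⟨_⟩ B z g) y) (e₂ : _∼_ B (_⟨_⟩ B y f) x)
        (e₃ : _∼_ B (_⟨_⟩ B z g′) y′) (e₄ : _∼_ B (_⟨_⟩ B y′ f′) x) →
        g ∘ f ≈ g′ ∘ f′ →
        _∼_ F (_⟨_⟩ F (_⟨_⟩ F a (g , e₁)) (f , e₂)) (_⟨_⟩ F (_⟨_⟩ F a (g′ , e₃)) (f′ , e₄))
      square a e₁ e₂ e₃ e₄ eq = ∼.trans F (∼.sym F (⟨∘⟩ F))
        (∼.trans F (⟨⟩-cong F (∼.refl F) eq) (⟨∘⟩ F))

    id∼ : (B : Presheaf C) → ∀ {V} {x y : El B V} → _∼_ B x y → _∼_ B (_⟨_⟩ B x id) y
    id∼ B = ∼.trans B (⟨id⟩ B)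

  TermEq-refl : ∀ {Γ} {A : Type Γ} {t : Term Γ A} → TermEq t t
  TermEq-refl {A = _⟪_⟫ {B} F σ} {t} =
    term-eq (λ _ → ∼.refl B) (λ γ e → same B F (val t γ) e)

  TermEq-sym : ∀ {Γ} {A A′ : Type Γ} {t : Term Γ A} {t′ : Term Γ A′} → TermEq t t′ → TermEq t′ t
  TermEq-sym (term-eq {B} {F} {t = t} {t′} e e′) = term-eq (λ γ → ∼.sym B (e γ)) λ γ e″ →
    ∼.trans F (⟨⟩-cong F (∼.sym F (e′ γ (id∼ B (e γ)))) ≈.refl)
      (∼.trans F (comp B F (val t γ) _ e″ (⟨id⟩ B) identityˡ) (same B F (val t γ) _))

  TermEq-trans : ∀ {Γ} {A₁ A₂ A₃ : Type Γ} {t₁ : Term Γ A₁} {t₂ : Term Γ A₂} {t₃ : Term Γ A₃} →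
    TermEq t₁ t₂ → TermEq t₂ t₃ → TermEq t₁ t₃
  TermEq-trans (term-eq {B} {F} {t = t₁} {t₂} e₁ e₂) (term-eq e₃ e₄) =
    term-eq (λ γ → ∼.trans B (e₁ γ) (e₃ γ)) λ γ e →
      ∼.trans F (∼.sym F (comp B F (val t₁ γ) (id∼ B (e₁ γ)) (id∼ B (e₃ γ)) e identityˡ))
        (∼.trans F (⟨⟩-cong F (e₂ γ _) ≈.refl) (e₄ γ (id∼ B (e₃ γ))))

  coerce : ∀ {Γ} {A A′ : Type Γ} → TypeEq A A′ → Term Γ A → Term Γ A′
  coerce {Γ} (type-eq {B} {F} {σ} e) t = record
    { val         = λ γ → _⟨_⟩ F (val t γ) (id , id∼ B (e γ))
    ; val-natural = λ {V} {W} {γ} {γ′} f eq eq′ →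
        ∼.trans F (square B F (val t γ) _ eq′ (∼.trans B (natural σ) (cong σ eq)) (id∼ B (e γ′))
            (≈.trans identityˡ (≈.sym identityʳ)))
          (⟨⟩-cong F (val-natural t f eq _) ≈.refl)
    }

  coerce-≈ : ∀ {Γ} {A A′ : Type Γ} (e : TypeEq A A′) (t : Term Γ A) → TermEq (coerce e t) t
  coerce-≈ (type-eq {B} {F} e) t = term-eq (λ γ → ∼.sym B (e γ)) λ γ e′ →
    ∼.trans F (comp B F (val t γ) _ e′ (⟨id⟩ B) identityˡ) (same B F (val t γ) _)

  _[_]Type : ∀ {Γ Δ} → Type Γ → Δ ⇒ Γ → Type Δ
  (F ⟪ σ ⟫) [ τ ]Type = F ⟪ Category._∘_ (Psh C) σ τ ⟫

  _[_]Term : ∀ {Γ Δ} {A : Type Γ} → Term Γ A → (τ : Δ ⇒ Γ) → Term Δ (A [ τ ]Type)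
  _[_]Term {Γ} t τ = record
    { val         = λ δ → val t (fun τ δ)
    ; val-natural = λ f eq eq′ → val-natural t f (∼.trans Γ (natural τ) (cong τ eq)) eq′
    }

  []Type-cong : ∀ {Γ Δ} {A A′ : Type Γ} {σ τ : Δ ⇒ Γ} → TypeEq A A′ →
    Category._≈_ (Psh C) σ τ → TypeEq (A [ σ ]Type) (A′ [ τ ]Type)
  []Type-cong (type-eq {B} {τ = τ} e) e′ = type-eq λ δ → ∼.trans B (e _) (cong τ (e′ δ))

  []Term-cong : ∀ {Γ Δ} {A A′ : Type Γ} {t : Term Γ A} {t′ : Term Γ A′} {σ τ : Δ ⇒ Γ} →
    TermEq t t′ → Category._≈_ (Psh C) σ τ → TermEq (t [ σ ]Term) (t′ [ τ ]Term)
  []Term-cong {Γ} {t = t} {σ = σ₁} {τ₁} (term-eq {B} {F} {σ} {τ} e e′) e″ =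
    term-eq (λ δ → ∼.trans B (e _) (cong τ (e″ δ))) λ δ eq →
      ∼.trans F (∼.sym F (comp B F (val t (fun σ₁ δ)) (id∼ B (cong σ (e″ δ))) (id∼ B (e _)) eq identityˡ))
        (∼.trans F (⟨⟩-cong F (val-natural t id (id∼ Γ (e″ δ)) _) ≈.refl) (e′ _ (id∼ B (e _))))

  ext : (Γ : Presheaf C) → Type Γ → Presheaf C
  ext Γ (_⟪_⟫ {B} F σ) = record
    { ob = λ V → record
        { Carrier = Σ (El Γ V) λ γ → El F (V , fun σ γ)
        ; _≈_     = λ (γ , x) (γ′ , x′) → _∼_ Γ γ γ′ ×
            (∀ (e : _∼_ B (_⟨_⟩ B (fun σ γ) id) (fun σ γ′)) → _∼_ F (_⟨_⟩ F x (id , e)) x′)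
        ; isEquivalence = record
            { refl  = λ { {γ , x} → ∼.refl Γ , same B F x }
            ; sym   = λ { {γ , x} {γ′ , x′} (e , e′) → ∼.sym Γ e , λ e″ →
                ∼.trans F (⟨⟩-cong F (∼.sym F (e′ (id∼ B (cong σ e)))) ≈.refl)
                  (∼.trans F (comp B F x _ e″ (⟨id⟩ B) identityˡ) (same B F x _)) }
            ; trans = λ { {γ , x} (e₁ , e₂) (e₃ , e₄) → ∼.trans Γ e₁ e₃ , λ e →
                ∼.trans F (∼.sym F (comp B F x (id∼ B (cong σ e₁)) (id∼ B (cong σ e₃)) e identityˡ))
                  (∼.trans F (⟨⟩-cong F (e₂ _) ≈.refl) (e₄ (id∼ B (cong σ e₃)))) }
            }
        }
    ; _⟨_⟩    = λ (γ , x) f → _⟨_⟩ Γ γ f , _⟨_⟩ F x (f , natural σ)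
    ; ⟨⟩-cong = λ { {x = γ , x} {γ′ , x′} (e₁ , e₂) e₃ → ⟨⟩-cong Γ e₁ e₃ , λ e →
        ∼.trans F (square B F x (natural σ) e (id∼ B (cong σ e₁)) (natural σ)
            (≈.trans identityʳ (≈.trans e₃ (≈.sym identityˡ))))
          (⟨⟩-cong F (e₂ _) ≈.refl) }
    ; ⟨id⟩    = λ { {x = γ , x} → ⟨id⟩ Γ , λ e →
        ∼.trans F (comp B F x _ e (⟨id⟩ B) identityˡ) (same B F x _) }
    ; ⟨∘⟩     = λ { {x = γ , x} → ⟨∘⟩ Γ , λ e →
        square B F x (natural σ) e (natural σ) (natural σ) identityʳ }
    }

  ext-p : ∀ {Γ} {A : Type Γ} → ext Γ A ⇒ Γ
  ext-p {Γ} = record { fun = proj₁ ; cong = proj₁ ; natural = ∼.refl Γ }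

  ext-q : ∀ {Γ} {A : Type Γ} → Term (ext Γ A) (A [ ext-p {A = A} ]Type)
  ext-q {A = _⟪_⟫ {B} F σ} = record
    { val         = proj₂
    ; val-natural = λ { {γ = γ , x} {γ′ , x′} f (e₁ , e₂) e →
        ∼.trans F (∼.sym F (comp B F x (natural σ) (id∼ B (cong σ e₁)) e identityʳ))
          (e₂ _) }
    }

  ext-pair : ∀ {Γ Δ} {A : Type Γ} (τ : Δ ⇒ Γ) → Term Δ (A [ τ ]Type) → Δ ⇒ ext Γ A
  ext-pair {Γ} {Δ} {_⟪_⟫ {B} F σ} τ t = record
    { fun     = λ δ → fun τ δ , val t δ
    ; cong    = λ e → cong τ e , val-natural t id (id∼ Δ e)
    ; natural = natural τ , λ e →
        ∼.trans F (comp B F (val t _) (natural σ) e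
            (∼.trans B (natural σ) (cong σ (natural τ))) identityʳ)
          (val-natural t _ (∼.refl Δ) _)
    }

  ext-pair-cong : ∀ {Γ Δ} {A : Type Γ} {σ τ : Δ ⇒ Γ}
    {t : Term Δ (A [ σ ]Type)} {t′ : Term Δ (A [ τ ]Type)} →
    Category._≈_ (Psh C) σ τ → TermEq t t′ →
    Category._≈_ (Psh C) (ext-pair {A = A} σ t) (ext-pair {A = A} τ t′)
  ext-pair-cong e (term-eq _ e′) δ = e δ , e′ δ

  ext-η : ∀ {Γ Δ} {A : Type Γ} {σ : Δ ⇒ ext Γ A}
    {t : Term Δ (A [ Category._∘_ (Psh C) (ext-p {A = A}) σ ]Type)} →
    TermEq t (ext-q {A = A} [ σ ]Term) →
    Category._≈_ (Psh C) (ext-pair {A = A} (Category._∘_ (Psh C) (ext-p {A = A}) σ) t) σ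
  ext-η {Γ} (term-eq _ e) δ = ∼.refl Γ , e δ

  propType : (P : Obj → Set ℓ) → (∀ {V W} → P W → Hom V W → P V) → ∀ {Γ} → Type Γ
  propType P restrict = record
    { base = 𝟏
    ; fam  = record
        { ob      = λ (V , _) → record
            { Carrier = P V ; _≈_ = λ _ _ → Unit.⊤
            ; isEquivalence = record { refl = _ ; sym = _ ; trans = _ } }
        ; _⟨_⟩    = λ x (f , _) → restrict x f
        ; ⟨⟩-cong = _
        ; ⟨id⟩    = _
        ; ⟨∘⟩     = _
        }
    ; sub  = record { fun = _ ; cong = _ ; natural = _ }
    }

  unitType : ∀ {Γ} → Type Γ
  unitType = propType (λ _ → Unit.⊤) _

  pshCwF : CwF (suc ℓ) ℓ
  pshCwF = record
    { ctx      = Psh C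
    ; terminal = Psh-terminal
    ; Ty       = Type
    ; _≈T_     = TypeEq
    ; ≈T-equiv = record
        { refl  = λ {A} → type-eq (λ _ → ∼.refl (Type.base A))
        ; sym   = λ { (type-eq {B} e) → type-eq λ γ → ∼.sym B (e γ) }
        ; trans = λ { (type-eq {B} e) (type-eq e′) → type-eq λ γ → ∼.trans B (e γ) (e′ γ) }
        }
    ; _[_]T    = _[_]Type
    ; []T-cong = []Type-cong
    ; [id]T    = λ {_} {A} → type-eq (λ _ → ∼.refl (Type.base A))
    ; [∘]T     = λ {_} {_} {_} {A} → type-eq (λ _ → ∼.refl (Type.base A))
    ; Tm       = Term
    ; _≈t_     = TermEq
    ; ≈t-type  = λ { (term-eq e _) → type-eq e }
    ; ≈t-refl  = TermEq-refl
    ; ≈t-sym   = TermEq-sym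
    ; ≈t-trans = TermEq-trans
    ; coe      = coerce
    ; coe-≈    = coerce-≈
    ; _[_]t    = _[_]Term
    ; []t-cong = []Term-cong
    ; [id]t    = λ {_} {A} {t} → term-eq (λ _ → ∼.refl (Type.base A)) (λ γ e → same (Type.base A) (Type.fam A) (val t γ) e)
    ; [∘]t     = λ {_} {_} {_} {A} {t} → term-eq (λ _ → ∼.refl (Type.base A)) (λ γ e → same (Type.base A) (Type.fam A) (val t _) e)
    ; _▹_      = ext
    ; p        = λ {_} {A} → ext-p {A = A}
    ; q        = λ {_} {A} → ext-q {A = A}
    ; ⟨_,_⟩    = λ {_} {_} {A} → ext-pair {A = A}
    ; ⟨,⟩-cong = λ {_} {_} {A} → ext-pair-cong {A = A}
    ; p-⟨,⟩    = λ {Γ} _ → ∼.refl Γ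
    ; q-⟨,⟩    = λ {_} {_} {A} {_} {t} → term-eq (λ _ → ∼.refl (Type.base A)) (λ γ e → same (Type.base A) (Type.fam A) (val t γ) e)
    ; ⟨,⟩-η    = λ {_} {_} {A} {σ} {t} → ext-η {A = A} {σ} {t}
    ; 𝟙        = unitType
    ; 𝟙[]      = type-eq _
    ; ⋆        = record { val = _ ; val-natural = _ }
    ; 𝟙-η      = λ _ → term-eq _ _
    }

module PresheafModel
  (𝒲 : Category ℓ ℓ) (term : Terminal 𝒲)
  (Shape : Set s) (mult : Shape → Multiplier 𝒲 term)
  where
  open Category 𝒲
  open Presheaf
  open Functor

  ⋉-functor : Shape → Functor 𝒲 𝒲
  ⋉-functor u = Multiplier.functor (mult u)

  _⋉𝐲_ : Presheaf 𝒲 → Shape → Presheaf 𝒲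
  Ξ ⋉𝐲 u = Lan₀ (⋉-functor u) Ξ

  -- 𝟏 is isomorphic to 𝐲⊤
  ⟦_⟧ : List Shape → Presheaf 𝒲
  ⟦ [] ⟧    = 𝟏
  ⟦ u ∷ X ⟧ = ⟦ X ⟧ ⋉𝐲 u

  𝖥/ : (Ξ : Presheaf 𝒲) (u : Shape) → Functor (∫ Ξ) (∫ (Ξ ⋉𝐲 u))
  𝖥/ Ξ u = ∫-Lan (⋉-functor u) Ξ

  -- ξ ⋉ 𝐲U, as an element of Ξ ⋉ 𝐲U
  _⋉𝐲ₑ_ : ∀ {Ξ W} → El Ξ W → (u : Shape) → El (Ξ ⋉𝐲 u) (F₀ (⋉-functor u) W)
  ξ ⋉𝐲ₑ u = cell ξ id

  OnBoundary : ∀ {Ξ u V} → El (Ξ ⋉𝐲 u) V → Set ℓ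
  OnBoundary {Ξ} {u} {V} φ =
    ¬ (Σ Obj λ W → Σ (Hom (F₀ (⋉-functor u) W) V) λ χ → Σ (El Ξ W) λ ξ →
       _∼_ (Ξ ⋉𝐲 u) (_⟨_⟩ (Ξ ⋉𝐲 u) φ χ) (ξ ⋉𝐲ₑ u))

  private
    restrict : ∀ {Ξ u V V′} {φ : El (Ξ ⋉𝐲 u) V} {φ′ : El (Ξ ⋉𝐲 u) V′} →
      OnBoundary {Ξ} {u} φ → Category.Hom (∫ (Ξ ⋉𝐲 u)) (V′ , φ′) (V , φ) → OnBoundary {Ξ} {u} φ′
    restrict {Ξ} {u} ∂φ (f , e) (W , χ , ξ , e′) = ∂φ (W , f ∘ χ , ξ ,
      ∼.trans P (⟨∘⟩ P) (∼.trans P (⟨⟩-cong P e ≈.refl) e′))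
      where
      P = Ξ ⋉𝐲 u

  boundary : (Ξ : Presheaf 𝒲) (u : Shape) {Γ : Presheaf (∫ (Ξ ⋉𝐲 u))} → PshCwF.Type (∫ (Ξ ⋉𝐲 u)) Γ
  boundary Ξ u = PshCwF.propType (∫ (Ξ ⋉𝐲 u))
    (λ (_ , φ) → OnBoundary {Ξ} {u} φ) (restrict {Ξ} {u})

  presheafModel : Model Shape (suc ℓ) ℓ
  presheafModel = record
    { cwf           = λ X → PshCwF.pshCwF (∫ ⟦ X ⟧)
    ; L∀-functor    = λ X u → Lan (𝖥/ ⟦ X ⟧ u)
    ; Lt-functor    = λ X u → Res (𝖥/ ⟦ X ⟧ u)
    ; const         = λ {X} {u} → Lan-unit (𝖥/ ⟦ X ⟧ u)
    ; app           = λ {X} {u} → Lan-counit (𝖥/ ⟦ X ⟧ u)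
    ; const-natural = λ {X} {u} → Lan-unit-natural (𝖥/ ⟦ X ⟧ u)
    ; app-natural   = λ {X} {u} → Lan-counit-natural (𝖥/ ⟦ X ⟧ u)
    ; triangle-∀    = λ {X} {u} → Lan-triangle₁ (𝖥/ ⟦ X ⟧ u)
    ; triangle-t    = λ {X} {u} → Lan-triangle₂ (𝖥/ ⟦ X ⟧ u)
    ; ∂             = λ {X} {u} → boundary ⟦ X ⟧ u
    ; ∂[]           = PshCwF.type-eq _
    ; ∂-irrel       = λ _ _ → PshCwF.term-eq _ _
    }

open PresheafModel public using (presheafModel)

{-# OPTIONS --safe #-}

-- Derivability: apply case to mod ⋆ : ⟨ 𝗍 ∣ 𝟙 ⟩ with a motive that ignores its
-- argument, so that the meridian branch is c∀ weakened by x : 𝟙.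
--
-- Soundness: a cell φ : V → Ξ ⋉ 𝐲U outside the boundary gives a dimensionally
-- split V → U.  Shard-freeness and fullness then make (V , φ) isomorphic to an
-- object 𝖥 (W , ξ) of the image of 𝖥 = 𝖥_U^{/Ξ}.  Since 𝖥 is full, the component
-- at (V , φ) of the co-unit app_Γ : Lan 𝖥 (Res 𝖥 Γ) ⇒ Γ is bijective.  Thus over
-- each cell a section of C is given either by c∂ or, through the inverse of app,
-- by c∀.
module Submission where

open import Level using (Level; suc; _⊔_)
open import Data.List using (List; _∷_)
open import Data.Product using (Σ; _×_; _,_; proj₁; proj₂)
open import Data.Sum using (_⊎_; inj₁; inj₂)
open import Axiom.ExcludedMiddle using (ExcludedMiddle)
open import Function.Bundles using (_⇔_; mk⇔; Equivalence)
open import Function.Properties.Equivalence using (⇔-isEquivalence)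
open import Relation.Nullary using (¬_; yes; no; contradiction)
open import Relation.Binary.Construct.Closure.Equivalence as EqC using ()
open import Defs

-- Derivability from pattern matching, in an arbitrary model.

module Derivation {s a b : Level} {Shape : Set s} (M : Model Shape a b) (X : List Shape) (u : Shape)
  (T : Transpension M X u) (E : TranspElim M X u T) where
  open Model M
  open Transpension T
  open TranspElim E

  -- Both projections of the composite are computed and reassembled by the η-law. The term `t′` is
  -- left free because `t [ τ ]t` has type `A [ σ ]T [ τ ]T`, which is equal but not identical to
  -- the type required.
  ⟨,⟩-∘ : ∀ {Y} {Γ Δ Θ : Con {Y}} {A : Ty Γ} {σ : Sub Δ Γ} {t : Tm Δ (A [ σ ]T)} {τ : Sub Θ Δ}
    {t′ : Tm Θ (A [ σ ∘ τ ]T)} → t′ ≈t t [ τ ]t →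
    ⟨_,_⟩ {A = A} σ t ∘ τ ≈s ⟨ σ ∘ τ , t′ ⟩
  ⟨,⟩-∘ {A = A} {σ} {t} {τ} {t′} e = ≈s.trans (≈s.sym (⟨,⟩-η {t = t″} (coe-≈ _ _)))
      (⟨,⟩-cong p-eq (≈t-trans (coe-≈ _ _)
        (≈t-trans [∘]t (≈t-trans ([]t-cong q-⟨,⟩ ≈s.refl) (≈t-sym e)))))
    where
    p-eq : p ∘ (⟨_,_⟩ {A = A} σ t ∘ τ) ≈s σ ∘ τ
    p-eq = ≈s.trans (≈s.sym assoc) (∘-cong p-⟨,⟩ ≈s.refl)

    t″ : Tm _ (A [ p ∘ (⟨ σ , t ⟩ ∘ τ) ]T)
    t″ = coe (≈T.sym [∘]T) (q [ ⟨ σ , t ⟩ ∘ τ ]t)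

  lift∂-∘ : {Γ Δ Θ : Con {u ∷ X}} {σ : Sub Δ Γ} {τ : Sub Θ Δ} →
    lift∂ {X} {u} σ ∘ lift∂ τ ≈s lift∂ (σ ∘ τ)
  lift∂-∘ {Γ} {Δ} {Θ} {σ} {τ} = ≈s.trans (⟨,⟩-∘ {t′ = coe ∂≈ q} eq)
      (⟨,⟩-cong (≈s.trans assoc (≈s.trans (∘-cong ≈s.refl p-⟨,⟩) (≈s.sym assoc)))
        (≈t-trans (coe-≈ _ _) (≈t-sym (coe-≈ _ _))))
    where
    ∂≈ : {σ : Sub (Θ ▹∂) Γ} → ∂ {X} {u} [ p∂ ]T ≈T ∂ {X} {u} [ σ ]T
    ∂≈ = ≈T.trans ∂[] (≈T.sym ∂[])

    eq : coe (∂≈ {(σ ∘ p∂) ∘ lift∂ τ}) q ≈t _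
    eq = ≈t-trans (coe-≈ _ _) (≈t-sym (≈t-trans ([]t-cong (coe-≈ _ _) ≈s.refl)
          (≈t-trans q-⟨,⟩ (coe-≈ _ _))))

  p∂-lift∂ : {Γ Δ : Con {u ∷ X}} {σ : Sub Δ Γ} → p∂ ∘ lift∂ {X} {u} σ ≈s σ ∘ p∂
  p∂-lift∂ = p-⟨,⟩

  [∘]t-cong : ∀ {Y} {Γ Δ Δ′ Θ : Con {Y}} {A : Ty Γ} {t : Tm Γ A}
    {σ : Sub Δ Γ} {τ : Sub Θ Δ} {σ′ : Sub Δ′ Γ} {τ′ : Sub Θ Δ′} →
    σ ∘ τ ≈s σ′ ∘ τ′ → t [ σ ]t [ τ ]t ≈t t [ σ′ ]t [ τ′ ]t
  [∘]t-cong e = ≈t-trans (≈t-sym [∘]t) (≈t-trans ([]t-cong ≈t-refl e) [∘]t)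

  p-lift : ∀ {Y} {Γ Δ : Con {Y}} {σ : Sub Δ Γ} {A : Ty Γ} {A′ : Ty Δ} {e : A′ ≈T A [ σ ]T} →
    p ∘ lift σ e ≈s σ ∘ p
  p-lift = p-⟨,⟩

  ⋆-natural : ∀ {Y} {Γ Δ : Con {Y}} {σ : Sub Δ Γ} → ⋆ ≈t ⋆ [ σ ]t
  ⋆-natural = ≈t-sym (≈t-trans (≈t-sym (coe-≈ 𝟙[] _)) (𝟙-η _))

  mod⋆ : {Γ : Con {u ∷ X}} → Tm Γ ⟨t∣ 𝟙 ⟩
  mod⋆ = mod ⋆

  module _ {Γ : Con {u ∷ X}} (C : Ty Γ)
    (c∂ : Tm (Γ ▹∂) (C [ p∂ ]T)) (c∀ : Tm (L∀ (Lt Γ)) (C [ app Γ ]T)) where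

    motive : Ty (Γ ▹ ⟨t∣ 𝟙 ⟩)
    motive = C [ p ]T

    cpole : Tm (Γ ▹∂) (motive [ [p,pole] ]T)
    cpole = coe (≈T.trans ([]T-cong ≈T.refl (≈s.sym p-⟨,⟩)) [∘]T) c∂

    cmerid : Tm (L∀ (Lt Γ ▹ 𝟙)) (motive [ [app,merid] ]T)
    cmerid = coe
      (≈T.trans (≈T.sym [∘]T) (≈T.trans ([]T-cong ≈T.refl (≈s.sym p-⟨,⟩)) [∘]T))
      (c∀ [ L∀₁ p ]t)

    -- This is the agreement of `c∀` with `c∂`, pulled back along `lift∂ (L∀₁ p)`, the weakening by
    -- `x : 𝟙`.
    coherent : c∀ [ p∂ ]t ≈t c∂ [ lift∂ (app Γ) ]t → Coherent cpole cmerid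
    coherent e =
      ≈t-trans ([]t-cong (coe-≈ _ _) ≈s.refl)
      (≈t-trans ([∘]t-cong (≈s.sym p∂-lift∂))
      (≈t-trans ([]t-cong e ≈s.refl)
      (≈t-trans (≈t-sym [∘]t)
      ([]t-cong (≈t-sym (coe-≈ _ _)) lift∂-∘))))

    motive-mod⋆ : motive [ ⟨id, mod⋆ ⟩ ]T ≈T C
    motive-mod⋆ = ≈T.trans (≈T.sym [∘]T) (≈T.trans ([]T-cong ≈T.refl p-⟨,⟩) [id]T)

  phiRule : PhiRule M X u
  phiRule = record
    { Φ = λ C c∂ c∀ e → coe (motive-mod⋆ C c∂ c∀)
        (case (motive C c∂ c∀) (cpole C c∂ c∀) (cmerid C c∂ c∀) (coherent C c∂ c∀ e) mod⋆)
    ; Φ-natural = λ σ eC e∂ e∀ → ≈t-trans (coe-≈ _ _) (≈t-trans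
        (case-natural σ (≈T.sym 𝟙[])
          (≈T.trans ([]T-cong eC ≈s.refl) (≈T.trans (≈T.sym [∘]T)
            (≈T.trans ([]T-cong ≈T.refl (≈s.sym p-lift)) [∘]T)))
          (≈t-trans (coe-≈ _ _) (≈t-trans e∂ ([]t-cong (≈t-sym (coe-≈ _ _)) ≈s.refl)))
          (≈t-trans (coe-≈ _ _) (≈t-trans ([]t-cong e∀ ≈s.refl)
            (≈t-trans
              ([∘]t-cong (≈s.trans (≈s.sym L∀-∘) (≈s.trans (L∀-cong (≈s.sym p-lift)) L∀-∘)))
              ([]t-cong (≈t-sym (coe-≈ _ _)) ≈s.refl))))
          (mod-natural σ ⋆-natural))
        ([]t-cong (≈t-sym (coe-≈ _ _)) ≈s.refl))
    ; Φ-∂ = ≈t-trans ([]t-cong (coe-≈ _ _) ≈s.refl) (≈t-trans case-pole (coe-≈ _ _))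
    -- The meridian branch is weakened by `p`, and `p ∘ ⟨ const Δ , unmerid t ⟩` is `const Δ`, so
    -- the value of `unmerid` is discarded.
    ; Φ-∀ = ≈t-trans (coe-≈ _ _) (≈t-trans case-merid
        (≈t-trans ([]t-cong (coe-≈ _ _) ≈s.refl) (≈t-trans (≈t-sym [∘]t)
          ([]t-cong ≈t-refl (≈s.trans (≈s.sym L∀-∘) (L∀-cong p-⟨,⟩))))))
    }
    where
    open Functor (L∀-functor X u) renaming (F-∘ to L∀-∘; F-cong to L∀-cong)

-- Equality across the fibres of a type.

module Displayed {ℓ : Level} {C : Category ℓ ℓ} where
  open Category C
  open Presheaf
  open _⇒_
  open PshCwF C

  -- The displayed arrows of ∫ F over those of C.  Over id compares elements of
  -- fibres of F over equal, but not identical, elements of B.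
  record Over (B : Presheaf C) (F : Presheaf (∫ B)) {V W : Obj} {x : El B V} {y : El B W}
      (f : Hom V W) (a : El F (W , y)) (b : El F (V , x)) : Set ℓ where
    constructor over
    field
      base-eq  : _∼_ B (_⟨_⟩ B y f) x
      fibre-eq : _∼_ F (_⟨_⟩ F a (f , base-eq)) b

  open Over public

  module _ {B : Presheaf C} {F : Presheaf (∫ B)} where

    -- Arrows of `∫ B` are compared by their underlying arrows alone, so the proof about base
    -- elements can be exchanged.
    over-any : ∀ {V W x y} {f : Hom V W} {a : El F (W , y)} {b : El F (V , x)} →
      Over B F f a b → (e : _∼_ B (_⟨_⟩ B y f) x) → _∼_ F (_⟨_⟩ F a (f , e)) b
    over-any r e = ∼.trans F (⟨⟩-cong F (∼.refl F) ≈.refl) (fibre-eq r)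

    over-cong : ∀ {V W x y} {f g : Hom V W} {a : El F (W , y)} {b : El F (V , x)} →
      f ≈ g → Over B F f a b → Over B F g a b
    over-cong e r = over (∼.trans B (⟨⟩-cong B (∼.refl B) (≈.sym e)) (base-eq r))
      (∼.trans F (⟨⟩-cong F (∼.refl F) (≈.sym e)) (fibre-eq r))

    over-∘ : ∀ {V W Z x y z} {f : Hom V W} {g : Hom W Z}
      {a : El F (Z , z)} {b : El F (W , y)} {c : El F (V , x)} →
      Over B F g a b → Over B F f b c → Over B F (g ∘ f) a c
    over-∘ r s = over (∼.trans B (⟨∘⟩ B) (∼.trans B (⟨⟩-cong B (base-eq r) ≈.refl) (base-eq s)))
      (∼.trans F (⟨∘⟩ F) (∼.trans F (⟨⟩-cong F (fibre-eq r) ≈.refl) (fibre-eq s)))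

    over-trans : ∀ {V x y z} {a : El F (V , z)} {b : El F (V , y)} {c : El F (V , x)} →
      Over B F id a b → Over B F id b c → Over B F id a c
    over-trans r s = over-cong identityˡ (over-∘ r s)

    over-sym : ∀ {V x y} {a : El F (V , y)} {b : El F (V , x)} → Over B F id a b → Over B F id b a
    over-sym {a = a} r = over e (∼.trans F (⟨⟩-cong F {g = id , e} (∼.sym F (fibre-eq r)) ≈.refl)
        (∼.trans F (∼.sym F (⟨∘⟩ F)) (∼.trans F (⟨⟩-cong F (∼.refl F) identityˡ) (⟨id⟩ F))))
      where
      e = ∼.trans B (⟨id⟩ B) (∼.trans B (∼.sym B (base-eq r)) (⟨id⟩ B))

    over-⟨⟩ : ∀ {V W x y} {f : Hom V W} (a : El F (W , y)) (e : _∼_ B (_⟨_⟩ B y f) x) →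
      Over B F f a (_⟨_⟩ F a (f , e))
    over-⟨⟩ a e = over e (∼.refl F)

    over-val : ∀ {Γ σ} (t : Term Γ (_⟪_⟫ {base = B} F σ))
      {V W} {γ : El Γ W} {γ′ : El Γ V} {f : Hom V W} →
      _∼_ Γ (_⟨_⟩ Γ γ f) γ′ → Over B F f (val t γ) (val t γ′)
    over-val {Γ} {σ} t e = over (∼.trans B (natural σ) (cong σ e)) (val-natural t _ e _)

    over-val-id : ∀ {Γ σ} (t : Term Γ (_⟪_⟫ {base = B} F σ)) {V} {γ γ′ : El Γ V} →
      _∼_ Γ γ γ′ → Over B F id (val t γ) (val t γ′)
    over-val-id {Γ} t e = over-val t (∼.trans Γ (⟨id⟩ Γ) e)

    over-TermEq : ∀ {Γ σ τ} {t : Term Γ (_⟪_⟫ {base = B} F σ)} {t′ : Term Γ (_⟪_⟫ {base = B} F τ)} →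
      TermEq t t′ → ∀ {V} (γ : El Γ V) → Over B F id (val t γ) (val t′ γ)
    over-TermEq (term-eq e e′) γ = over (∼.trans B (⟨id⟩ B) (e γ)) (e′ γ _)

    TermEq-over : ∀ {Γ σ τ} {t : Term Γ (_⟪_⟫ {base = B} F σ)} {t′ : Term Γ (_⟪_⟫ {base = B} F τ)} →
      (∀ {V} (γ : El Γ V) → Over B F id (val t γ) (val t′ γ)) → TermEq t t′
    TermEq-over r = term-eq
      (λ γ → ∼.trans B (∼.sym B (⟨id⟩ B)) (base-eq (r γ)))
      (λ γ → over-any (r γ))

open Displayed

-- Invertibility of the co-unit on the image of a full functor.

module _ {ℓ : Level} {C D : Category ℓ ℓ} (F : Functor C D) where
  private
    module C = Category C
    module D = Category D
  open Functor F
  open Presheaf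
  open _⇒_
  open Cell

  Full : Set ℓ
  Full = ∀ {A B} (g : D.Hom (F₀ A) (F₀ B)) → Σ (C.Hom A B) λ f → F₁ f D.≈ g

  FullyFaithful⇒Full : FullyFaithful F → Full
  FullyFaithful⇒Full ff g with f , e ← proj₂ (ff _ _) g = f , e C.≈.refl

  module _ (full : Full) (Q : Presheaf D) {c : C.Obj} {d : D.Obj} (i : Iso D (F₀ c) d) where
    open Iso i
    private
      LQ = Lan₀ F (Res₀ F Q)

    -- The inverse of the co-unit at `d`: moving `x` along `to` makes it an element of `Res₀ F Q` at
    -- `c`, and `from` records the way back.
    Lan-counit-section : El Q d → Cell F (Res₀ F Q) d
    Lan-counit-section x = cell (_⟨_⟩ Q x to) from

    Lan-counit-∘section : (x : El Q d) → _∼_ Q (fun (Lan-counit F Q) (Lan-counit-section x)) x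
    Lan-counit-∘section x =
      ∼.trans Q (∼.sym Q (⟨∘⟩ Q)) (∼.trans Q (⟨⟩-cong Q (∼.refl Q) to∘from) (⟨id⟩ Q))

    -- Fullness writes `k ∘ to` as `F₁ h`, and `h` is a single generating step from the section to
    -- the given cell.
    Lan-section∘counit : (x : Cell F (Res₀ F Q) d) {y : El Q d} → _∼_ Q (fun (Lan-counit F Q) x) y →
      _∼_ LQ x (Lan-counit-section y)
    Lan-section∘counit (cell x k) {y} e with h , e′ ← full (k D.∘ to) =
      EqC.symmetric _ (EqC.return (h , eq , D.≈.trans (D.∘-cong e′ D.≈.refl) (D.≈.trans D.assoc
        (D.≈.trans (D.∘-cong D.≈.refl to∘from) D.identityʳ))))
      where
      eq : _∼_ Q (_⟨_⟩ Q x (F₁ h)) (_⟨_⟩ Q y to)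
      eq = ∼.trans Q (⟨⟩-cong Q (∼.refl Q) e′) (∼.trans Q (⟨∘⟩ Q) (⟨⟩-cong Q e D.≈.refl))

-- Gluing a section from its boundary part and its interior part.

-- P plays the role of u ∈ ∂𝕌.
module Gluing {ℓ : Level} {C D : Category ℓ ℓ} (F : Functor C D) (full : Full F)
  (P : Category.Obj D → Set ℓ)
  (restrict : ∀ {V W} → P W → Category.Hom D V W → P V)
  (decide : ∀ d → P d ⊎ (¬ P d × Σ (Category.Obj C) λ c → Iso D (Functor.F₀ F c) d))
  where
  private
    module D = Category D
  open Functor F
  open Presheaf
  open _⇒_
  open PshCwF D

  LR : Presheaf D → Presheaf D
  LR Γ = Lan₀ F (Res₀ F Γ)

  app : ∀ Γ → LR Γ ⇒ Γ
  app = Lan-counit F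

  -- The premises of the Φ-rule read cell by cell: `on∂` for `c∂`, `on∀` for `c∀`, `agree` for their
  -- compatibility. That `b` and `b′` are unrelated in `on∂-natural` expresses proof irrelevance of
  -- the boundary.
  record Pieces {Γ : Presheaf D} (C : Type Γ) : Set ℓ where
    open Type C
    field
      on∂         : ∀ {V} (γ : El Γ V) → P V → El fam (V , fun sub γ)
      on∂-natural : ∀ {V W} {γ : El Γ W} {γ′ : El Γ V} {f : D.Hom V W} {b : P W} {b′ : P V} →
        _∼_ Γ (_⟨_⟩ Γ γ f) γ′ → Over base fam f (on∂ γ b) (on∂ γ′ b′)
      on∀         : ∀ {V} (x : El (LR Γ) V) → El fam (V , fun sub (fun (app Γ) x))
      on∀-natural : ∀ {V W} {x : El (LR Γ) W} {x′ : El (LR Γ) V} {f : D.Hom V W} →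
        _∼_ (LR Γ) (_⟨_⟩ (LR Γ) x f) x′ → Over base fam f (on∀ x) (on∀ x′)
      agree       : ∀ {V} (x : El (LR Γ) V) (b : P V) →
        Over base fam D.id (on∀ x) (on∂ (fun (app Γ) x) b)

    on∂-cong : ∀ {V} {γ γ′ : El Γ V} {b b′ : P V} →
      _∼_ Γ γ γ′ → Over base fam D.id (on∂ γ b) (on∂ γ′ b′)
    on∂-cong e = on∂-natural (∼.trans Γ (⟨id⟩ Γ) e)

    on∀-cong : ∀ {V} {x x′ : El (LR Γ) V} →
      _∼_ (LR Γ) x x′ → Over base fam D.id (on∀ x) (on∀ x′)
    on∀-cong e = on∀-natural (∼.trans (LR Γ) (⟨id⟩ (LR Γ)) e)

  open Pieces

  module _ {Γ : Presheaf D} {C : Type Γ} (c : Pieces C) where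
    open Type C

    -- A specification free of the case split. It determines `a`: by `glued-∂` on the boundary, and
    -- elsewhere by `glued-∀`, since `γ` then has a preimage under `app Γ`.
    record IsGlued {V : D.Obj} (γ : El Γ V) (a : El fam (V , fun sub γ)) : Set ℓ where
      field
        glued-∂ : (b : P V) → Over base fam D.id (on∂ c γ b) a
        glued-∀ : (x : El (LR Γ) V) → _∼_ Γ (fun (app Γ) x) γ → Over base fam D.id (on∀ c x) a

    open IsGlued public

    glue : ∀ {V} (γ : El Γ V) → Σ (El fam (V , fun sub γ)) (IsGlued γ)
    glue {V} γ with decide V
    ... | inj₁ b = on∂ c γ b , record
      { glued-∂ = λ _ → on∂-cong c (∼.refl Γ)
      ; glued-∀ = λ x e → over-trans (agree c x b) (on∂-cong c e)
      }
    -- The value is `on∀` at the section of the co-unit, transported to `γ`; any other preimage `x`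
    -- equals that section.
    ... | inj₂ (¬b , _ , i) = _ , record
      { glued-∂ = λ b → contradiction b ¬b
      ; glued-∀ = λ x e → over-trans (on∀-cong c (Lan-section∘counit F full Γ i x e))
          (over-⟨⟩ (on∀ c (Lan-counit-section F full Γ i γ))
            (∼.trans base (⟨id⟩ base) (cong sub (Lan-counit-∘section F full Γ i γ))))
      }

    -- Only the cell `W` is examined: a boundary proof, or a preimage under `app Γ`, restricts along
    -- `f` and so settles the value at `V` too.
    glue-natural : ∀ {V W} {γ : El Γ W} {γ′ : El Γ V} {a a′} {f : D.Hom V W} →
      _∼_ Γ (_⟨_⟩ Γ γ f) γ′ → IsGlued γ a → IsGlued γ′ a′ → Over base fam f a a′
    glue-natural {V} {W} {f = f} e g g′ with decide W
    ... | inj₁ b = over-cong D.identityˡ (over-∘ (over-sym (glued-∂ g b))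
      (over-cong D.identityʳ (over-∘ (on∂-natural c e) (glued-∂ g′ (restrict b f)))))
    ... | inj₂ (_ , _ , i) = over-cong D.identityˡ
      (over-∘ (over-sym (glued-∀ g x app-x))
      (over-cong D.identityʳ (over-∘ (on∀-natural c (∼.refl (LR Γ)))
        (glued-∀ g′ (_⟨_⟩ (LR Γ) x f) (∼.trans Γ (∼.sym Γ (natural (app Γ)))
          (∼.trans Γ (⟨⟩-cong Γ app-x D.≈.refl) e))))))
      where
      x = Lan-counit-section F full Γ i _
      app-x = Lan-counit-∘section F full Γ i _

    glueTerm : Term Γ C
    glueTerm = record
      { val         = λ γ → proj₁ (glue γ)
      ; val-natural = λ f e → over-any (glue-natural e (proj₂ (glue _)) (proj₂ (glue _)))
      }

    glueTerm-isGlued : ∀ {V} (γ : El Γ V) → IsGlued γ (val glueTerm γ)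
    glueTerm-isGlued γ = proj₂ (glue γ)

  module _ {Γ Δ : Presheaf D} (σ : Δ ⇒ Γ) {C : Type Γ} (c : Pieces C)
    {ρ : Δ ⇒ Type.base C} (c′ : Pieces (Type.fam C ⟪ ρ ⟫)) where
    open Type C

    -- At each cell one clause of `IsGlued` determines both values. The two types share a family
    -- because `TypeEq` only relates types that do.
    glueTerm-natural :
      (∀ {V} (δ : El Δ V) (b : P V) →
        Over base fam D.id (on∂ c′ δ b) (on∂ c (fun σ δ) b)) →
      (∀ {V} (x : El (LR Δ) V) →
        Over base fam D.id (on∀ c′ x) (on∀ c (fun (Lan₁ F (Functor.F₁ (Res F) σ)) x))) →
      ∀ {V} (δ : El Δ V) → Over base fam D.id (val (glueTerm c′) δ) (val (glueTerm c) (fun σ δ))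
    glueTerm-natural e∂ e∀ {V} δ
      with decide V | glueTerm-isGlued c′ δ | glueTerm-isGlued c (fun σ δ)
    ... | inj₁ b | g′ | g =
      over-trans (over-sym (glued-∂ g′ b)) (over-trans (e∂ δ b) (glued-∂ g b))
    ... | inj₂ (_ , _ , i) | g′ | g =
      over-trans (over-sym (glued-∀ g′ x app-x)) (over-trans (e∀ x)
        (glued-∀ g _ (∼.trans Γ (∼.sym Γ (Lan-counit-natural F σ x)) (cong σ app-x))))
      where
      x = Lan-counit-section F full Δ i δ
      app-x = Lan-counit-∘section F full Δ i δ

-- Cells off the boundary and the image of `𝖥/Ξ`.

module Boundary {ℓ : Level} {𝒲 : Category ℓ ℓ} {term : Terminal 𝒲} (M : Multiplier 𝒲 term)
  (ff : Multiplier.⊤-SliceFullyFaithful M) (Ξ : Presheaf 𝒲) where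
  open Category 𝒲
  open Multiplier M
  open Functor functor using (F₁; F-∘; F-id)
  open Presheaf
  open Cell

  Ξ⋉U : Presheaf 𝒲
  Ξ⋉U = Lan₀ functor Ξ

  𝖥/Ξ : Functor (∫ Ξ) (∫ Ξ⋉U)
  𝖥/Ξ = ∫-Lan functor Ξ

  π₂-natural : ∀ {W W′} (f : Hom W W′) → π₂ ∘ F₁ f ≈ π₂
  π₂-natural f = proj₂ (Functor.F₁ 𝖥 f)

  -- The projection from `Ξ ⋉ 𝐲U` to `𝐲U`, computed on representatives.
  dimension : ∀ {V} → El Ξ⋉U V → Hom V U
  dimension φ = π₂ ∘ map φ

  dimension-cong : ∀ {V} {φ φ′ : El Ξ⋉U V} → _∼_ Ξ⋉U φ φ′ → dimension φ ≈ dimension φ′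
  dimension-cong = EqC.gfold equiv dimension λ (f , _ , e) →
    ≈.trans (∘-cong (≈.sym (π₂-natural f)) ≈.refl) (≈.trans assoc (∘-cong ≈.refl e))

  𝖥-full : ∀ {W W′} (g : Hom (W ⋉U) (W′ ⋉U)) → π₂ ∘ g ≈ π₂ → Σ (Hom W W′) λ h → F₁ h ≈ g
  𝖥-full g e = FullyFaithful⇒Full 𝖥 ff (g , e)

  𝖥-faithful : ∀ {W W′} {f g : Hom W W′} → F₁ f ≈ F₁ g → f ≈ g
  𝖥-faithful = proj₁ (ff _ _)

  -- Being a lift can be transported along the equivalence closure, which makes it
  -- the induction predicate for fullness of 𝖥/Ξ.
  Lifts : ∀ {W} → El Ξ W → El Ξ⋉U (W ⋉U) → Set ℓ
  Lifts {W} ξ φ = Σ (Hom W (shape φ)) λ h → (F₁ h ≈ map φ) × (_∼_ Ξ (_⟨_⟩ Ξ (elt φ) h) ξ)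

  -- For a generating step along `f`, lifts move forward by composing with `f`. Backward, fullness
  -- supplies `h` and faithfulness shows that `f ∘ h` is the given lift.
  Lifts-cong : ∀ {W} {ξ : El Ξ W} {φ φ′ : El Ξ⋉U (W ⋉U)} →
    _∼_ Ξ⋉U φ φ′ → Lifts ξ φ ⇔ Lifts ξ φ′
  Lifts-cong {ξ = ξ} = EqC.gfold ⇔-isEquivalence (Lifts ξ) λ (f , e₁ , e₂) → mk⇔
    (λ (h , e₃ , e₄) → f ∘ h
      , ≈.trans F-∘ (≈.trans (∘-cong ≈.refl e₃) e₂)
      , ∼.trans Ξ (⟨∘⟩ Ξ) (∼.trans Ξ (⟨⟩-cong Ξ e₁ ≈.refl) e₄))
    (λ (h′ , e₃ , e₄) →
      let Ff∘g≈Fh′ = ≈.trans e₂ (≈.sym e₃)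
          h , e₅ = 𝖥-full _ (≈.trans (∘-cong (≈.sym (π₂-natural f)) ≈.refl) (≈.trans assoc
            (≈.trans (∘-cong ≈.refl Ff∘g≈Fh′) (π₂-natural h′))))
          f∘h≈h′ = 𝖥-faithful (≈.trans F-∘ (≈.trans (∘-cong ≈.refl e₅) Ff∘g≈Fh′))
      in h , e₅ , ∼.trans Ξ (⟨⟩-cong Ξ (∼.sym Ξ e₁) ≈.refl) (∼.trans Ξ (∼.sym Ξ (⟨∘⟩ Ξ))
        (∼.trans Ξ (⟨⟩-cong Ξ (∼.refl Ξ) f∘h≈h′) e₄)))

  𝖥/-full : Full 𝖥/Ξ
  𝖥/-full {A = W , ξ} (k , e)
    -- The cell `[ ξ , id ]` lifts through `id`; transporting this along `e` gives a lift of `k`.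
    with h , e₁ , e₂ ← Equivalence.from (Lifts-cong {ξ = ξ} e) (id , F-id , ⟨id⟩ Ξ) =
      (h , e₂) , ≈.trans e₁ identityˡ

  Interior : ∀ {V} → El Ξ⋉U V → Set ℓ
  Interior {V} φ = Σ Obj λ W → Σ (Hom (W ⋉U) V) λ χ → Σ (El Ξ W) λ ξ →
    _∼_ Ξ⋉U (_⟨_⟩ Ξ⋉U φ χ) (cell ξ id)

  -- Through `χ`, the dimension of `φ` is split, so shard-freeness yields `V ≅ W₁ ⋉U` over `U`.
  -- Fullness then absorbs `map φ ∘ to` into an arrow `h` of `𝒲`, which exhibits `φ` restricted
  -- along `to` as `[ elt φ ⟨ h ⟩ , id ]`.
  interior⇒image : ⊤-SliceShardFree → ∀ {V} (φ : El Ξ⋉U V) → Interior φ →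
    Σ (Category.Obj (∫ Ξ)) λ c → Iso (∫ Ξ⋉U) (Functor.F₀ 𝖥/Ξ c) (V , φ)
  interior⇒image shardFree {V} φ (W , χ , ξ , e)
    with W₁ , i ← shardFree V (dimension φ)
           (W , χ , ≈.trans assoc (≈.trans (dimension-cong e) identityʳ))
    with h , e′ ← 𝖥-full (map φ ∘ proj₁ (Iso.to i)) (≈.trans (≈.sym assoc) (proj₂ (Iso.to i))) =
    (W₁ , _⟨_⟩ Ξ (elt φ) h) , record
      { to      = proj₁ to , φ⟨to⟩
      ; from    = proj₁ from , (∼.trans Ξ⋉U (⟨⟩-cong Ξ⋉U (∼.sym Ξ⋉U φ⟨to⟩) ≈.refl)
          (∼.trans Ξ⋉U (∼.sym Ξ⋉U (⟨∘⟩ Ξ⋉U))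
          (∼.trans Ξ⋉U (⟨⟩-cong Ξ⋉U {x = φ} (∼.refl Ξ⋉U) to∘from) (⟨id⟩ Ξ⋉U))))
      ; from∘to = from∘to
      ; to∘from = to∘from
      }
    where
    open Iso i
    φ⟨to⟩ : _∼_ Ξ⋉U (_⟨_⟩ Ξ⋉U φ (proj₁ to)) (cell (_⟨_⟩ Ξ (elt φ) h) id)
    φ⟨to⟩ = EqC.symmetric _ (EqC.return (h , ∼.refl Ξ , ≈.trans identityʳ e′))

-- Soundness in the presheaf model.

module _ {s a b : Level} {Shape : Set s} (M : Model Shape a b) (X : List Shape) (u : Shape) where
  open Model M

  record PhiPremises (Γ : Con {u ∷ X}) : Set (a ⊔ b) where
    constructor premises
    field
      C  : Ty Γ
      c∂ : Tm (Γ ▹∂) (C [ p∂ ]T)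
      c∀ : Tm (L∀ (Lt Γ)) (C [ app Γ ]T)
      e  : c∀ [ p∂ ]t ≈t c∂ [ lift∂ (app Γ) ]t

module Soundness {ℓ s : Level} (𝒲 : Category ℓ ℓ) (term : Terminal 𝒲)
  (Shape : Set s) (mult : Shape → Multiplier 𝒲 term) (X : List Shape) (u : Shape)
  (ff : Multiplier.⊤-SliceFullyFaithful (mult u)) (sf : Multiplier.⊤-SliceShardFree (mult u))
  (em : ExcludedMiddle ℓ) where
  open PresheafModel 𝒲 term Shape mult using (⟦_⟧; boundary; OnBoundary; 𝖥/; _⋉𝐲_)
  open Boundary (mult u) ff ⟦ X ⟧ using (Interior; interior⇒image; 𝖥/-full)
  open Presheaf
  open _⇒_
  open PshCwF (∫ (⟦ X ⟧ ⋉𝐲 u))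

  IsBoundary : Category.Obj (∫ (⟦ X ⟧ ⋉𝐲 u)) → Set ℓ
  IsBoundary d = OnBoundary {⟦ X ⟧} {u} (proj₂ d)

  decide : ∀ d → IsBoundary d ⊎
    (¬ IsBoundary d × Σ (Category.Obj (∫ ⟦ X ⟧)) λ c →
      Iso (∫ (⟦ X ⟧ ⋉𝐲 u)) (Functor.F₀ (𝖥/ ⟦ X ⟧ u) c) d)
  -- `OnBoundary` is by definition the negation of `Interior`, so a negative answer is itself a
  -- boundary proof.
  decide (V , φ) with em {Interior φ}
  ... | yes i = inj₂ ((λ b → b i) , interior⇒image sf φ i)
  ... | no ¬i = inj₁ ¬i

  open Gluing (𝖥/ ⟦ X ⟧ u) 𝖥/-full IsBoundary
    -- Restriction of boundary proofs is the presheaf action of the type `boundary`, whose family is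
    -- the same in every context; `𝟏` is one choice.
    (λ {V} {W} b f → _⟨_⟩ (Type.fam (boundary ⟦ X ⟧ u {𝟏})) {V , _} {W , _} b (f , _)) decide

  Premises : Presheaf (∫ (⟦ X ⟧ ⋉𝐲 u)) → Set (suc ℓ)
  Premises = PhiPremises (presheafModel 𝒲 term Shape mult) X u

  pieces : ∀ {Γ} (c : Premises Γ) → Pieces (PhiPremises.C c)
  pieces {Γ} (premises C c∂ c∀ e) = record
    { on∂         = λ γ b → val c∂ (γ , b)
    ; on∂-natural = λ e′ → over-val c∂ (e′ , _)
    ; on∀         = λ x → val c∀ x
    ; on∀-natural = λ e′ → over-val c∀ e′
    ; agree       = λ x b → over-trans
        (over-TermEq {B = Type.base C} {F = Type.fam C} e (x , b)) (over-val-id c∂ (∼.refl Γ , _))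
    }

  phi : ∀ {Γ} (c : Premises Γ) → Term Γ (PhiPremises.C c)
  phi c = glueTerm (pieces c)

  -- τ is lift∂ σ; only its first component matters, since proofs of u ∈ ∂𝕌 are irrelevant.
  phi-natural : ∀ {Γ Δ} (σ : Δ ⇒ Γ)
    (c : Premises Γ) (c′ : Premises Δ)
    (τ : ext Δ (boundary ⟦ X ⟧ u) ⇒ ext Γ (boundary ⟦ X ⟧ u)) →
    (∀ {V} (δ : El Δ V) (b : IsBoundary V) → _∼_ Γ (proj₁ (fun τ (δ , b))) (fun σ δ)) →
    TypeEq (PhiPremises.C c′) (PhiPremises.C c [ σ ]Type) →
    TermEq (PhiPremises.c∂ c′) (PhiPremises.c∂ c [ τ ]Term) →
    TermEq (PhiPremises.c∀ c′)
      (PhiPremises.c∀ c [ Lan₁ (𝖥/ ⟦ X ⟧ u) (Functor.F₁ (Res (𝖥/ ⟦ X ⟧ u)) σ) ]Term) →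
    TermEq (phi c′) (phi c [ σ ]Term)
  phi-natural {Γ} σ c@(premises C c∂ c∀ e) c′@(premises _ c∂′ c∀′ e′) τ τ-eq (type-eq _) e∂ e∀ =
    TermEq-over (glueTerm-natural σ (pieces c) (pieces c′)
      (λ δ b → over-trans (over-TermEq {B = Type.base C} {F = Type.fam C} e∂ (δ , b))
        (over-val-id c∂ (τ-eq δ b , _)))
      (over-TermEq {B = Type.base C} {F = Type.fam C} e∀))

  phi-∂ : ∀ {Γ} (c : Premises Γ) →
    TermEq (phi c [ ext-p {A = boundary ⟦ X ⟧ u} ]Term) (PhiPremises.c∂ c)
  phi-∂ c@(premises _ _ _ _) = TermEq-over λ (γ , b) →
    over-sym (glued-∂ (glueTerm-isGlued (pieces c) γ) b)

  sound : PhiRule (presheafModel 𝒲 term Shape mult) X u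
  sound = record
    { Φ         = λ C c∂ c∀ e → phi (premises C c∂ c∀ e)
    ; Φ-natural = λ { {Γ} σ {C = C} {c∂} {c∀} {e} {C′} {c∂′} {c∀′} {e′} eC e∂ e∀ →
        phi-natural σ (premises C c∂ c∀ e) (premises C′ c∂′ c∀′ e′) _ (λ _ _ → ∼.refl Γ) eC e∂ e∀ }
    ; Φ-∂       = λ {_} {C} {c∂} {c∀} {e} → phi-∂ (premises C c∂ c∀ e)
    -- By the triangle identity, `L∀₁ (const Δ)` sends `γ` to a preimage of `γ` under the co-unit,
    -- where `glued-∀` applies.
    ; Φ-∀       = λ {Δ} {C} {c∂} {c∀} {e} → TermEq-over λ γ →
        over-sym (glued-∀ (glueTerm-isGlued (pieces (premises C c∂ c∀ e)) γ) _
          (Lan-triangle₁ (𝖥/ ⟦ X ⟧ u) Δ γ))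
    }

theorem10p1 : {ℓ s a b : Level} →
    ((𝒲 : Category ℓ ℓ) (term : Terminal 𝒲)
    (Shape : Set s) (mult : Shape → Multiplier 𝒲 term) (X : List Shape) (u : Shape) →
    Multiplier.⊤-SliceFullyFaithful (mult u) →
    Multiplier.⊤-SliceShardFree (mult u) →
    ExcludedMiddle ℓ →
    PhiRule (presheafModel 𝒲 term Shape mult) X u)
    ×
    ((Shape : Set s) (M : Model Shape a b) (X : List Shape) (u : Shape)
    (T : Transpension M X u) →
    TranspElim M X u T →
    PhiRule M X u)
theorem10p1 =
    (λ 𝒲 term Shape mult X u ff sf em → Soundness.sound 𝒲 term Shape mult X u ff sf em)
  , (λ Shape M X u T E → Derivation.phiRule M X u T E)
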